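{- Let $\mathbf{D}'$ be the category whose objects are naturally ordered finite distributive lattices and whose morphisms are positive surjective lattice homomorphisms. Then $\mathbf{D}'$ has the dual Ramsey property (for morphisms); that is, for every integer $k\ge2$ and all objects $\mathcal{K}_\prec$, $\mathcal{L}_\sqsubset$ of $\mathbf{D}'$ with $\hom_{\mathbf{D}'}(\mathcal{L}_\sqsubset,\mathcal{K}_\prec)\neq\varnothing$ there is an object $\mathcal{N}_\triangleleft$ of $\mathbf{D}'$ such that for every $k$-coloring $\hom_{\mathbf{D}'}(\mathcal{N}_\triangleleft,\mathcal{K}_\prec)=\mathcal{M}_1\cup\dots\cup\mathcal{M}_k$ there are $i\in\{1,\dots,k\}$ and $w\in\hom_{\mathbf{D}'}(\mathcal{N}_\triangleleft,\mathcal{L}_\sqsubset)$ such that $f\circ w\in\mathcal{M}_i$ for all $f\in\hom_{\mathbf{D}'}(\mathcal{L}_\sqsubset,\mathcal{K}_\prec)$.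
   Context: Lattices have bottom $0$ and top $1$ in the signature, and homomorphisms preserve them; $\le$ (strict part $<$) denotes the lattice order. $J(\mathcal{L})$ is the set of join-irreducible elements of $\mathcal{L}$ ($0$ is not join-irreducible); the empty join is $0$. Natural order: let $\sqsubset^0$ be a (strict) linear order on $J(\mathcal{L})$ extending $<$ on $J(\mathcal{L})$, and write $J(\mathcal{L})=\{j_1\sqsubset^0\dots\sqsubset^0 j_n\}$. For $x\in L$ let $\delta_i(x)=1$ if $j_i\le x$ and $\delta_i(x)=0$ otherwise. The antilexicographic order $\sqsubset$ on $L$ with respect to $\sqsubset^0$ is: $x\sqsubset y$ iff there is $s$ with $\delta_s(x)<\delta_s(y)$ and $\delta_t(x)=\delta_t(y)$ for all $t>s$. A linear order on $L$ is natural if it arises this way from some such $\sqsubset^0$. A naturally ordered finite distributive lattice $\mathcal{L}_\sqsubset$ is a finite distributive lattice $\mathcal{L}$ together with a natural linear order $\sqsubset$; $\sqsubseteq$ is the reflexive version of $\sqsubset$. For a lattice homomorphism $f:\mathcal{L}\to\mathcal{K}$ let $N(f)=\{x\in L : \exists y\in L\ (y<x \text{ and } f(y)=f(x))\}$, and for $x\in L$, $S\subseteq L$ let $x-S=\bigvee\{j\in J(\mathcal{L}) : j\le x,\ j\notin S\}$. A lattice homomorphism $f$ from $\mathcal{L}_\sqsubset$ to $\mathcal{K}_\prec$ is positive if for all $x,y\in L$: $x-N(f)\sqsubseteq y-N(f)$ implies $f(x)\preceq f(y)$. A $k$-coloring of a set is a decomposition of it into $k$ pairwise disjoint (possibly empty)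 subsets. Positive surjective homomorphisms are closed under composition and contain the identities, so $\mathbf{D}'$ is a category. -}

module Defs where

open import Algebra.Definitions using (_DistributesOverˡ_)
open import Algebra.Lattice.Bundles using (RawLattice)
open import Algebra.Lattice.Morphism.Structures using (IsLatticeHomomorphism)
open import Data.Fin.Base using (Fin)
import Data.Fin.Induction as Fin
import Data.Fin.Properties as Fin
open import Data.List.Base using (List; []; _∷_; filter; foldr; tabulate)
open import Data.List.Membership.Propositional using (_∈_)
open import Data.List.Membership.Propositional.Properties using (∈-filter⁺; ∈-tabulate⁺)
open import Data.List.Relation.Unary.All as All using (All; []; _∷_)
open import Data.List.Relation.Unary.All.Properties using (all-filter)
open import Data.List.Relation.Unary.Any using (here; there)
open import Data.Nat.Base as ℕ using (ℕ)
open import Data.Product.Base using (Σ; ∃; ∃₂; _×_; _,_; proj₁; proj₂)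
open import Data.Sum.Base using (_⊎_; inj₁; inj₂)
open import Data.Bool.Base using (if_then_else_)
open import Function.Base using (_∘_; _on_; id)
open import Function.Bundles using (Inverse; _⇔_)
open import Function.Definitions using (Surjective)
open import Induction.WellFounded using (WellFounded; Acc; acc)
open import Level using (Level; 0ℓ; suc; _⊔_)
open import Relation.Binary.Bundles using (Setoid)
import Relation.Binary.Construct.NonStrictToStrict as NonStrictToStrict
import Relation.Binary.Construct.StrictToNonStrict as StrictToNonStrict
open import Relation.Binary.Core using (Rel)
open import Relation.Binary.Lattice.Bundles using (BoundedLattice)
open import Relation.Binary.PropositionalEquality as ≡ using (_≡_; _≢_)
open import Relation.Binary.Structures using (IsEquivalence; IsStrictTotalOrder)
import Relation.Binary.Definitions as Binary
open import Relation.Nullary.Decidable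
  using (Dec; yes; no; does; map′; ¬?; _×-dec_; decidable-stable)
open import Relation.Nullary.Negation using (¬_; contradiction)
open import Relation.Unary using (Pred; Decidable; _⊥_; _∉_) renaming (_∈_ to _∈ᴾ_)

record FiniteDistributiveLattice : Set₁ where
  field
    boundedLattice : BoundedLattice 0ℓ 0ℓ 0ℓ

  open BoundedLattice boundedLattice public
    hiding (lattice) renaming (⊤ to 𝟏; ⊥ to 𝟎)

  field
    ∧-distribˡ-∨ : _DistributesOverˡ_ _≈_ _∧_ _∨_
    size         : ℕ
    enumeration  : Inverse (≡.setoid (Fin size)) setoid

  open NonStrictToStrict _≈_ _≤_ public using (_<_)

  rawLattice : RawLattice 0ℓ 0ℓ
  rawLattice = record { _≈_ = _≈_ ; _∧_ = _∧_ ; _∨_ = _∨_ }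

  private
    module E = Inverse enumeration

    elem : Fin size → Carrier
    elem = E.to

    index : Carrier → Fin size
    index = E.from

    elem-index : ∀ x → elem (index x) ≈ x
    elem-index = E.strictlyInverseˡ

  elements : List Carrier
  elements = tabulate elem

  infix 4 _≈?_ _≤?_ _<?_

  _≈?_ : Binary.Decidable _≈_
  x ≈? y = map′
    (λ p → Eq.trans (Eq.sym (elem-index x)) (Eq.trans (E.to-cong p) (elem-index y)))
    E.from-cong (index x Fin.≟ index y)

  _≤?_ : Binary.Decidable _≤_
  x ≤? y = map′
    (λ p → trans (reflexive (Eq.sym p)) (x∧y≤y x y))
    (λ p → antisym (x∧y≤x x y) (∧-greatest refl p))
    ((x ∧ y) ≈? x)

  _<?_ : Binary.Decidable _<_
  x <? y = (x ≤? y) ×-dec ¬? (x ≈? y)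

  any? : {P : Pred Carrier 0ℓ} → (∀ {x y} → x ≈ y → P x → P y) →
         Decidable P → Dec (∃ P)
  any? resp P? = map′
    (λ (i , p) → elem i , p)
    (λ (x , p) → index x , resp (Eq.sym (elem-index x)) p)
    (Fin.any? (λ i → P? (elem i)))

  <-wellFounded : WellFounded _<_
  <-wellFounded x = go x (Fin.spo-wellFounded <-spo (index x))
    where
    <-spo = record
      { isEquivalence = record
        { refl = Eq.refl ; sym = Eq.sym ; trans = Eq.trans }
      ; irrefl = λ i≈j (_ , i≉j) → i≉j i≈j
      ; trans  = NonStrictToStrict.<-trans _≈_ _≤_ isPartialOrder
      ; <-resp-≈ =
          (λ p (a , b) → trans a (reflexive p) , λ q → b (Eq.trans q (Eq.sym p)))
        , (λ p (a , b) → trans (reflexive (Eq.sym p)) a , λ q → b (Eq.trans p q))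
      }

    go : ∀ x → Acc (_<_ on elem) (index x) → Acc _<_ x
    go x (acc rs) = acc λ {y} (y≤x , y≉x) → go y (rs
      ( trans (reflexive (elem-index y)) (trans y≤x (reflexive (Eq.sym (elem-index x))))
      , λ p → y≉x (Eq.trans (Eq.sym (elem-index y)) (Eq.trans p (elem-index x)))))

  JoinIrreducible : Pred Carrier 0ℓ
  JoinIrreducible j = ¬ j ≈ 𝟎 × (∀ a b → j ≈ a ∨ b → j ≈ a ⊎ j ≈ b)

  J : Set
  J = ∃ JoinIrreducible

  infix 4 _≈ᴶ_ _<ᴶ_

  _≈ᴶ_ : Rel J 0ℓ
  _≈ᴶ_ = _≈_ on proj₁

  _<ᴶ_ : Rel J 0ℓ
  _<ᴶ_ = _<_ on proj₁

  joinIrreducible-resp : ∀ {x y} → x ≈ y → JoinIrreducible x → JoinIrreducible y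
  joinIrreducible-resp {x} {y} p (≉0 , irr) = (λ q → ≉0 (Eq.trans p q)) , irr′
    where
    irr′ : ∀ a b → y ≈ a ∨ b → y ≈ a ⊎ y ≈ b
    irr′ a b q with irr a b (Eq.trans p q)
    ... | inj₁ r = inj₁ (Eq.trans (Eq.sym p) r)
    ... | inj₂ r = inj₂ (Eq.trans (Eq.sym p) r)

  Splits : Pred Carrier 0ℓ
  Splits x = ∃₂ λ a b → x ≈ a ∨ b × ¬ x ≈ a × ¬ x ≈ b

  ∨-cong : ∀ {a b c d} → a ≈ b → c ≈ d → a ∨ c ≈ b ∨ d
  ∨-cong {a} {b} {c} {d} p q = antisym
    (∨-least (trans (reflexive p) (x≤x∨y b d)) (trans (reflexive q) (y≤x∨y b d)))
    (∨-least (trans (reflexive (Eq.sym p)) (x≤x∨y a c))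
             (trans (reflexive (Eq.sym q)) (y≤x∨y a c)))

  splits? : Decidable Splits
  splits? x = any?
    (λ { p (b , q , r , s) → b , Eq.trans q (∨-cong p Eq.refl) ,
         (λ t → r (Eq.trans t (Eq.sym p))) , s })
    (λ a → any?
      (λ { p (q , r , s) → Eq.trans q (∨-cong Eq.refl p) , r ,
           λ t → s (Eq.trans t (Eq.sym p)) })
      (λ b → (x ≈? a ∨ b) ×-dec ¬? (x ≈? a) ×-dec ¬? (x ≈? b)))

  irreducible⊎zero⊎splits : ∀ x → JoinIrreducible x ⊎ x ≈ 𝟎 ⊎ Splits x
  irreducible⊎zero⊎splits x with x ≈? 𝟎 | splits? x
  ... | yes p | _     = inj₂ (inj₁ p)
  ... | no  _ | yes s = inj₂ (inj₂ s)
  ... | no ≉0 | no ¬s = inj₁ (≉0 , irr)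
    where
    irr : ∀ a b → x ≈ a ∨ b → x ≈ a ⊎ x ≈ b
    irr a b p with x ≈? a | x ≈? b
    ... | yes q | _     = inj₁ q
    ... | no  _ | yes q = inj₂ q
    ... | no ≉a | no ≉b = contradiction (a , b , p , ≉a , ≉b) ¬s

  joinIrreducible? : Decidable JoinIrreducible
  joinIrreducible? x with irreducible⊎zero⊎splits x
  ... | inj₁ irr = yes irr
  ... | inj₂ (inj₁ p) = no λ (≉0 , _) → ≉0 p
  ... | inj₂ (inj₂ (a , b , p , ≉a , ≉b)) = no λ (_ , irr) → absurd (irr a b p)
    where
    absurd : ¬ (x ≈ a ⊎ x ≈ b)
    absurd (inj₁ q) = ≉a q
    absurd (inj₂ q) = ≉b q

  ⋁ : {P : Pred Carrier 0ℓ} → Decidable P → Carrier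
  ⋁ P? = foldr _∨_ 𝟎 (filter P? elements)

  Below-outside : Carrier → Pred Carrier 0ℓ → Pred Carrier 0ℓ
  Below-outside x S j = JoinIrreducible j × j ≤ x × j ∉ S

  below-outside? : ∀ x {S} → Decidable S → Decidable (Below-outside x S)
  below-outside? x S? j = joinIrreducible? j ×-dec (j ≤? x) ×-dec ¬? (S? j)

  infixl 6 _-_

  _-_ : Carrier → {S : Pred Carrier 0ℓ} → Decidable S → Carrier
  x - S? = ⋁ (below-outside? x S?)

  private
    ≤-foldr : ∀ {x} xs → x ∈ xs → x ≤ foldr _∨_ 𝟎 xs
    ≤-foldr (x ∷ xs) (here ≡.refl) = x≤x∨y x _
    ≤-foldr (y ∷ xs) (there p)     = trans (≤-foldr xs p) (y≤x∨y y _)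

    foldr-≤ : ∀ {z} {xs} → All (_≤ z) xs → foldr _∨_ 𝟎 xs ≤ z
    foldr-≤ []       = minimum _
    foldr-≤ (p ∷ ps) = ∨-least p (foldr-≤ ps)

  ⋁-upper : {P : Pred Carrier 0ℓ} (P? : Decidable P) →
            (∀ {x y} → x ≈ y → P x → P y) → ∀ {x} → P x → x ≤ ⋁ P?
  ⋁-upper P? resp {x} px = trans (reflexive (Eq.sym (elem-index x)))
    (≤-foldr _ (∈-filter⁺ P? (∈-tabulate⁺ (index x)) (resp (Eq.sym (elem-index x)) px)))

  ⋁-least : {P : Pred Carrier 0ℓ} (P? : Decidable P) →
            ∀ {z} → (∀ {x} → P x → x ≤ z) → ⋁ P? ≤ z
  ⋁-least P? h = foldr-≤ (All.map h (all-filter P? elements))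

  record IsLinearExtension (_⊏⁰_ : Rel J 0ℓ) : Set where
    field
      isStrictTotalOrder : IsStrictTotalOrder _≈ᴶ_ _⊏⁰_
      extends            : ∀ {i j} → i <ᴶ j → i ⊏⁰ j

  -- The coordinates are indexed by the join-irreducibles themselves,
  -- ordered by ⊏⁰, instead of by their positions 1, …, n in that order.
  δ : J → Carrier → ℕ
  δ j x = if does (proj₁ j ≤? x) then 1 else 0

  Antilex : Rel J 0ℓ → Rel Carrier 0ℓ
  Antilex _⊏⁰_ x y =
    ∃ λ s → δ s x ℕ.< δ s y × (∀ t → s ⊏⁰ t → δ t x ≡ δ t y)

  record IsNaturalOrder (_⊏_ : Rel Carrier 0ℓ) : Set₁ where
    field
      isStrictTotalOrder : IsStrictTotalOrder _≈_ _⊏_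
      _⊏⁰_               : Rel J 0ℓ
      isLinearExtension  : IsLinearExtension _⊏⁰_
      antilex            : ∀ x y → x ⊏ y ⇔ Antilex _⊏⁰_ x y

record NaturallyOrderedLattice : Set₁ where
  infix 4 _⊏_
  field
    lattice        : FiniteDistributiveLattice
    _⊏_            : Rel (FiniteDistributiveLattice.Carrier lattice) 0ℓ
    isNaturalOrder : FiniteDistributiveLattice.IsNaturalOrder lattice _⊏_

  open FiniteDistributiveLattice lattice public
  open IsNaturalOrder isNaturalOrder public using (isStrictTotalOrder)
  open StrictToNonStrict _≈_ _⊏_ public using () renaming (_≤_ to _⊑_)

  ⊑-resp : ∀ {x x′ y y′} → x ≈ x′ → y ≈ y′ → x ⊑ y → x′ ⊑ y′
  ⊑-resp p q (inj₁ r) = inj₁ (proj₁ <-resp-≈ q (proj₂ <-resp-≈ p r))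
    where open IsStrictTotalOrder isStrictTotalOrder using (<-resp-≈)
  ⊑-resp p q (inj₂ r) = inj₂ (Eq.trans (Eq.sym p) (Eq.trans r q))

module _ (L K : FiniteDistributiveLattice) where
  private
    module L = FiniteDistributiveLattice L
    module K = FiniteDistributiveLattice K

  record IsBoundedLatticeHomomorphism (f : L.Carrier → K.Carrier) : Set where
    field
      isLatticeHomomorphism : IsLatticeHomomorphism L.rawLattice K.rawLattice f
      𝟎-homo                : f L.𝟎 K.≈ K.𝟎
      𝟏-homo                : f L.𝟏 K.≈ K.𝟏

    open IsLatticeHomomorphism isLatticeHomomorphism public
      using (∧-homo; ∨-homo; ⟦⟧-cong)

  N : (L.Carrier → K.Carrier) → Pred L.Carrier 0ℓ
  N f x = ∃ λ y → y L.< x × f y K.≈ f x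

  module Homomorphism {f : L.Carrier → K.Carrier}
                      (hom : IsBoundedLatticeHomomorphism f) where
    open IsBoundedLatticeHomomorphism hom

    N? : Decidable (N f)
    N? x = L.any?
      (λ { p ((a , b) , c) →
           (L.trans (L.reflexive (L.Eq.sym p)) a , λ q → b (L.Eq.trans p q)) ,
           K.Eq.trans (⟦⟧-cong (L.Eq.sym p)) c })
      (λ y → (y L.<? x) ×-dec (f y K.≈? f x))

    mono : ∀ {x y} → x L.≤ y → f x K.≤ f y
    mono {x} {y} p = K.trans (K.x≤x∨y (f x) (f y)) (K.reflexive (K.Eq.trans
      (K.Eq.sym (∨-homo x y))
      (⟦⟧-cong (L.antisym (L.∨-least p L.refl) (L.y≤x∨y x y)))))

    N-resp : ∀ {x y} → x L.≈ y → N f x → N f y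
    N-resp p (z , (a , b) , c) =
      z , (L.trans a (L.reflexive p) , λ q → b (L.Eq.trans q (L.Eq.sym p))) ,
      K.Eq.trans c (⟦⟧-cong p)

    below-outside-resp : ∀ x {i j} → i L.≈ j →
                         L.Below-outside x (N f) i → L.Below-outside x (N f) j
    below-outside-resp x p (irr , i≤x , i∉N) =
      L.joinIrreducible-resp p irr , L.trans (L.reflexive (L.Eq.sym p)) i≤x ,
      λ q → i∉N (N-resp (L.Eq.sym p) q)

    infix 8 _⁻

    _⁻ : L.Carrier → L.Carrier
    x ⁻ = x L.- N?

    -- x ⁻ is the least element of the fibre of f through x; this is what
    -- makes positivity closed under composition.

    ⁻-≤ : ∀ x → x ⁻ L.≤ x
    ⁻-≤ x = L.⋁-least (L.below-outside? x N?) (proj₁ ∘ proj₂)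

    ⁻-fibre : ∀ x → f (x ⁻) K.≈ f x
    ⁻-fibre x = K.antisym (mono (⁻-≤ x)) (go x (L.<-wellFounded x) L.refl)
      where
      go : ∀ z → Acc L._<_ z → z L.≤ x → f z K.≤ f (x ⁻)
      go z (acc rs) z≤x with L.irreducible⊎zero⊎splits z
      ... | inj₂ (inj₁ z≈0) =
        K.trans (K.reflexive (K.Eq.trans (⟦⟧-cong z≈0) 𝟎-homo)) (K.minimum _)
      ... | inj₂ (inj₂ (a , b , p , ≉a , ≉b)) = K.trans
        (K.reflexive (K.Eq.trans (⟦⟧-cong p) (∨-homo a b)))
        (K.∨-least (go a (rs (a≤z , ≉a ∘ L.Eq.sym)) (L.trans a≤z z≤x))
                   (go b (rs (b≤z , ≉b ∘ L.Eq.sym)) (L.trans b≤z z≤x)))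
        where
        a≤z = L.trans (L.x≤x∨y a b) (L.reflexive (L.Eq.sym p))
        b≤z = L.trans (L.y≤x∨y a b) (L.reflexive (L.Eq.sym p))
      ... | inj₁ irr with N? z
      ... | yes (y , y<z , p) = K.trans (K.reflexive (K.Eq.sym p))
        (go y (rs y<z) (L.trans (proj₁ y<z) z≤x))
      ... | no z∉N = mono (L.⋁-upper (L.below-outside? x N?)
        (below-outside-resp x) (irr , z≤x , z∉N))

    ⁻-least : ∀ x z → f z K.≈ f x → x ⁻ L.≤ z
    ⁻-least x z p = L.⋁-least (L.below-outside? x N?) step
      where
      step : ∀ {j} → L.Below-outside x (N f) j → j L.≤ z
      step {j} (_ , j≤x , j∉N) = L.trans
        (L.reflexive (L.Eq.sym (decidable-stable (j L.∧ z L.≈? j)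
          λ ≉ → j∉N (j L.∧ z , (L.x∧y≤x j z , ≉) , same))))
        (L.x∧y≤y j z)
        where
        same : f (j L.∧ z) K.≈ f j
        same = K.antisym (mono (L.x∧y≤x j z)) (K.trans
          (K.∧-greatest K.refl (K.trans (mono j≤x) (K.reflexive (K.Eq.sym p))))
          (K.reflexive (K.Eq.sym (∧-homo j z))))

module _ (L K : NaturallyOrderedLattice) where
  private
    module L = NaturallyOrderedLattice L
    module K = NaturallyOrderedLattice K

  Positive : {f : L.Carrier → K.Carrier} →
             IsBoundedLatticeHomomorphism L.lattice K.lattice f → Set
  Positive {f} hom = ∀ x y → x L.- N? L.⊑ y L.- N? → f x K.⊑ f y
    where open Homomorphism L.lattice K.lattice hom using (N?)

  record PositiveSurjection : Set where
    field
      ⟦_⟧            : L.Carrier → K.Carrier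
      isHomomorphism : IsBoundedLatticeHomomorphism L.lattice K.lattice ⟦_⟧
      surjective     : Surjective L._≈_ K._≈_ ⟦_⟧
      positive       : Positive isHomomorphism

    open IsBoundedLatticeHomomorphism isHomomorphism public
    open Homomorphism L.lattice K.lattice isHomomorphism public

-- Morphisms are identified when they agree as functions.
positiveSurjections : (L K : NaturallyOrderedLattice) → Setoid 0ℓ 0ℓ
positiveSurjections L K = record
  { Carrier       = PositiveSurjection L K
  ; _≈_           = λ f g → ∀ x → ⟦ f ⟧ x K.≈ ⟦ g ⟧ x
  ; isEquivalence = record
    { refl  = λ _ → K.Eq.refl
    ; sym   = λ p x → K.Eq.sym (p x)
    ; trans = λ p q x → K.Eq.trans (p x) (q x)
    }
  }
  where
  module K = NaturallyOrderedLattice K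
  open PositiveSurjection using (⟦_⟧)

identity : ∀ L → PositiveSurjection L L
identity L = record
  { ⟦_⟧            = id
  ; isHomomorphism = hom
  ; surjective     = λ y → y , id
  ; positive       = λ x y → L.⊑-resp (⁻-fibre x) (⁻-fibre y)
  }
  where
  module L = NaturallyOrderedLattice L
  hom : IsBoundedLatticeHomomorphism L.lattice L.lattice id
  hom = record
    { isLatticeHomomorphism = record
      { isRelHomomorphism = record { cong = id }
      ; ∧-homo = λ _ _ → L.Eq.refl
      ; ∨-homo = λ _ _ → L.Eq.refl
      }
    ; 𝟎-homo = L.Eq.refl
    ; 𝟏-homo = L.Eq.refl
    }
  open Homomorphism L.lattice L.lattice hom using (⁻-fibre)

compose : ∀ {L K M} → PositiveSurjection K M → PositiveSurjection L K →
          PositiveSurjection L M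
compose {L} {K} {M} g f = record
  { ⟦_⟧            = λ x → g.⟦ f.⟦ x ⟧ ⟧
  ; isHomomorphism = hom
  ; surjective     = surj
  ; positive       = pos
  }
  where
  module L = NaturallyOrderedLattice L
  module K = NaturallyOrderedLattice K
  module M = NaturallyOrderedLattice M
  module f = PositiveSurjection f
  module g = PositiveSurjection g

  hom : IsBoundedLatticeHomomorphism L.lattice M.lattice (λ x → g.⟦ f.⟦ x ⟧ ⟧)
  hom = record
    { isLatticeHomomorphism = record
      { isRelHomomorphism = record { cong = g.⟦⟧-cong ∘ f.⟦⟧-cong }
      ; ∧-homo = λ x y → M.Eq.trans (g.⟦⟧-cong (f.∧-homo x y)) (g.∧-homo _ _)
      ; ∨-homo = λ x y → M.Eq.trans (g.⟦⟧-cong (f.∨-homo x y)) (g.∨-homo _ _)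
      }
    ; 𝟎-homo = M.Eq.trans (g.⟦⟧-cong f.𝟎-homo) g.𝟎-homo
    ; 𝟏-homo = M.Eq.trans (g.⟦⟧-cong f.𝟏-homo) g.𝟏-homo
    }
  module gf = Homomorphism L.lattice M.lattice hom

  surj : Surjective L._≈_ M._≈_ (λ x → g.⟦ f.⟦ x ⟧ ⟧)
  surj z with g.surjective z
  ... | y , y↦z with f.surjective y
  ... | x , x↦y = x , y↦z ∘ x↦y

  ⁻-absorb : ∀ x → (x gf.⁻) f.⁻ L.≈ x gf.⁻
  ⁻-absorb x = L.antisym (f.⁻-≤ _)
    (gf.⁻-least x _ (M.Eq.trans (g.⟦⟧-cong (f.⁻-fibre (x gf.⁻))) (gf.⁻-fibre x)))

  ⁻-image : ∀ x → f.⟦ x gf.⁻ ⟧ K.≈ f.⟦ x ⟧ g.⁻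
  ⁻-image x with f.surjective (f.⟦ x ⟧ g.⁻)
  ... | t , t↦ = K.antisym
    (K.trans
      (f.mono (gf.⁻-least x t
        (M.Eq.trans (g.⟦⟧-cong (t↦ L.Eq.refl)) (g.⁻-fibre f.⟦ x ⟧))))
      (K.reflexive (t↦ L.Eq.refl)))
    (g.⁻-least f.⟦ x ⟧ f.⟦ x gf.⁻ ⟧ (gf.⁻-fibre x))

  pos : Positive L M hom
  pos x y p = g.positive f.⟦ x ⟧ f.⟦ y ⟧
    (K.⊑-resp (⁻-image x) (⁻-image y)
      (f.positive (x gf.⁻) (y gf.⁻)
        (L.⊑-resp (L.Eq.sym (⁻-absorb x)) (L.Eq.sym (⁻-absorb y)) p)))

record Category (o ℓ : Level) : Set (suc (o ⊔ ℓ)) where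
  infixr 9 _∘ᶜ_
  field
    Obj : Set o
    hom : Obj → Obj → Setoid ℓ ℓ

  Hom : Obj → Obj → Set ℓ
  Hom A B = Setoid.Carrier (hom A B)

  infix 4 _≋_
  _≋_ : ∀ {A B} → Rel (Hom A B) ℓ
  _≋_ {A} {B} = Setoid._≈_ (hom A B)

  field
    idᶜ       : ∀ {A} → Hom A A
    _∘ᶜ_      : ∀ {A B C} → Hom B C → Hom A B → Hom A C
    ∘-cong    : ∀ {A B C} {g g′ : Hom B C} {f f′ : Hom A B} →
                g ≋ g′ → f ≋ f′ → g ∘ᶜ f ≋ g′ ∘ᶜ f′
    assoc     : ∀ {A B C D} (h : Hom C D) (g : Hom B C) (f : Hom A B) →
                (h ∘ᶜ g) ∘ᶜ f ≋ h ∘ᶜ (g ∘ᶜ f)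
    identityˡ : ∀ {A B} (f : Hom A B) → idᶜ ∘ᶜ f ≋ f
    identityʳ : ∀ {A B} (f : Hom A B) → f ∘ᶜ idᶜ ≋ f

-- Subsets of a setoid are predicates respecting its equality.
record Coloring {ℓ} (k : ℕ) (A : Setoid ℓ ℓ) : Set (suc ℓ) where
  open Setoid A
  field
    part     : Fin k → Pred Carrier ℓ
    resp     : ∀ i {x y} → x ≈ y → x ∈ᴾ part i → y ∈ᴾ part i
    cover    : ∀ x → ∃ λ i → x ∈ᴾ part i
    disjoint : ∀ {i j} → i ≢ j → part i ⊥ part j

DualRamseyProperty : ∀ {o ℓ} → Category o ℓ → Set (o ⊔ suc ℓ)
DualRamseyProperty C =
  ∀ (k : ℕ) → 2 ℕ.≤ k → ∀ (K L : Obj) → Hom L K →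
  Σ Obj λ N → (M : Coloring k (hom N K)) →
  Σ (Fin k) λ i → Σ (Hom N L) λ w → (f : Hom L K) → f ∘ᶜ w ∈ᴾ Coloring.part M i
  where open Category C

D′ : Category (suc 0ℓ) 0ℓ
D′ = record
  { Obj       = NaturallyOrderedLattice
  ; hom       = positiveSurjections
  ; idᶜ       = λ {A} → identity A
  ; _∘ᶜ_      = compose
  ; ∘-cong    = λ {A} {B} {C} {g} {g′} {f} {f′} p q x →
                  Setoid.trans (NaturallyOrderedLattice.setoid C)
                    (PositiveSurjection.⟦⟧-cong g (q x)) (p (PositiveSurjection.⟦_⟧ f′ x))
  ; assoc     = λ {A} {B} {C} {D} _ _ _ _ → Setoid.refl (NaturallyOrderedLattice.setoid D)
  ; identityˡ = λ {A} {B} _ _ → Setoid.refl (NaturallyOrderedLattice.setoid B)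
  ; identityʳ = λ {A} {B} _ _ → Setoid.refl (NaturallyOrderedLattice.setoid B)
  }

{-# OPTIONS --safe #-}

-- Sending f : L → K to the map that takes a join-irreducible k to the least x with
-- k ≤ f x identifies D′ with the opposite of the category of finite posets with a
-- linear extension, and positivity says that f is a rigid surjection for ⊑: the
-- least elements of its fibres increase with their images. A map from a set of n
-- generators to K extends to a homomorphism from the free bounded distributive
-- lattice on them, which under a suitable natural order is a positive surjection
-- as soon as the nonzero elements of K occur, for the first time in increasing
-- order, among the n values. Such sequences of values are words with parameters,
-- on which f : L → K acts by substitution, so the Graham–Rothschild theorem
-- provides n.
module Submission where

open import Defs
open import Data.Bool.Base as Bool using (Bool; true; false; T; if_then_else_; f<t)
import Data.Bool.Properties as Bool
open import Data.Empty using (⊥)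
open import Data.Fin.Base as Fin
  using (Fin; zero; suc; toℕ; combine; remQuot; funToFin; finToFun)
import Data.Fin.Properties as Fin
open import Data.List.Base as List
  using (List; []; _∷_; length; foldr; filter; cartesianProductWith; deduplicate)
open import Data.List.Membership.Propositional using (_∈_)
open import Data.List.Membership.Propositional.Properties
  using (∈-filter⁻; ∈-tabulate⁺; ∈-lookup)
import Data.List.Membership.Setoid.Properties as SetoidMembership
open import Data.List.Relation.Unary.All as All using (All; []; _∷_)
open import Data.List.Relation.Unary.AllPairs using ([]; _∷_)
open import Data.List.Relation.Unary.Any as Any using (Any; here; there)
import Data.List.Relation.Unary.Any.Properties as Any
open import Data.List.Relation.Unary.Enumerates.Setoid using (IsEnumeration)
import Data.List.Relation.Unary.Enumerates.Setoid.Properties as Enumerates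
import Data.List.Relation.Unary.Unique.DecSetoid.Properties as Unique
open import Data.List.Relation.Unary.Unique.Setoid using (Unique)
open import Data.Nat.Base as ℕ
  using (ℕ; zero; suc; _+_; _^_; z≤n; s≤s; s≤s⁻¹; z<s; s<s; s<s⁻¹)
import Data.Nat.Properties as ℕ
open import Data.Product.Base as Product using (Σ; ∃; _×_; _,_; proj₁; proj₂; swap)
open import Data.Product.Function.NonDependent.Propositional using (_×-⇔_)
open import Data.Sum.Base as Sum using (_⊎_; inj₁; inj₂)
open import Data.Sum.Function.Propositional using (_⊎-⇔_)
open import Data.Unit.Base using (⊤; tt)
open import Data.Vec.Base as Vec using (Vec; []; _∷_)
open import Data.Vec.Functional using () renaming (_∷_ to _▹_)
import Data.Vec.Properties as Vec
import Data.Vec.Relation.Binary.Lex.Strict as Lex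
open Lex using (Lex-<; this; next)
open import Data.Vec.Relation.Binary.Pointwise.Inductive as Pointwise
  using (Pointwise; []; _∷_)
open import Data.Vec.Relation.Unary.All as Allᵛ using ([]; _∷_) renaming (All to Allᵛ)
open import Data.Vec.Relation.Unary.AllPairs using (AllPairs; []; _∷_)
open import Data.Vec.Relation.Unary.Any as Anyᵛ using (here; there) renaming (Any to Anyᵛ)
open import Data.Vec.Relation.Unary.Any.Properties using (lookup-index)
open import Function.Base using (_∘_; id; const)
open import Function.Bundles using (Inverse; Equivalence; _⇔_; mk⇔)
import Function.Construct.Composition as ⇔
open import Function.Definitions using (Surjective)
open import Induction.WellFounded using (Acc; acc)
open import Level using (0ℓ)
open import Relation.Binary.Bundles using (Setoid; DecSetoid)
open import Relation.Binary.Core using (Rel)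
open import Relation.Binary.Definitions using (Tri; tri<; tri≈; tri>; Trichotomous)
import Relation.Binary.Lattice.Properties.MeetSemilattice as MeetSemilattice
open import Relation.Binary.PropositionalEquality as ≡
  using (_≡_; _≗_; refl; sym; trans; cong; cong₂; subst; module ≡-Reasoning)
open import Relation.Binary.Structures using (IsStrictTotalOrder)
open import Relation.Binary.Structures.Biased using (isStrictTotalOrderᶜ)
open import Relation.Nullary.Decidable
  using (Dec; yes; no; does; ⌊_⌋; isYes≗does; does-⇔; toWitness; fromWitness; map′
        ; decidable-stable; ¬?; _×-dec_; _⊎-dec_; _→-dec_)
open import Relation.Nullary.Negation using (¬_; contradiction)
open import Relation.Unary using (Pred; Decidable)

open Equivalence using () renaming (to to ⇒; from to ⇐)

-- The only letter needed for lattices stands for 𝟎: its fibre always contains 𝟎, so 𝟎 has no first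
-- occurrence to be placed, whereas the nonzero elements are the parameters. The Graham-Rothschild
-- theorem is nevertheless proved for all nonempty finite alphabets together, because its induction
-- on the number of parameters regards whatever follows the first parameter as a word with one
-- parameter less over one letter more. The base case, without parameters, is the Hales-Jewett
-- theorem. The induction step removes the dependence of a colour on everything but the letters
-- before the first parameter, on everything but their number, and on that number.
--
-- The natural order that makes words positive compares irreducibles of the free lattice
-- lexicographically by the variables above them. Variables carry the values listed by a word, so
-- the first variable that separates two irreducibles carries a value at its first occurrence, and
-- the prescribed order of first occurrences decides the comparison.

private variable
  a b c k l m n p : ℕ
  X Y             : Set

-- Word a m n: words of length n over the alphabet Fin a with m parameters.  A
-- parameter is introduced by ν at its first occurrence and is from then on
-- letter zero of the enlarged alphabet, so first occurrences are in order.
infixr 5 _∷_ ν_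

data Word : ℕ → ℕ → ℕ → Set where
  []  : Word a 0 0
  _∷_ : Fin a → Word a m n → Word a m (suc n)
  ν_  : Word (suc a) m n → Word a (suc m) (suc n)

-- Substitution into words with parameters

lift : (Fin a → Fin b) → Fin (suc a) → Fin (suc b)
lift σ = zero ▹ (suc ∘ σ)

-- The map `σ` is an environment: besides renaming the letters of `w`, it records what has been put
-- for the parameters introduced so far.
sub : (Fin a → Fin b) → Word a l n → Word b m l → Word b m n
sub σ []      []      = []
sub σ (x ∷ w) v       = σ x ∷ sub σ w v
sub σ (ν w)   (x ∷ v) = x ∷ sub (x ▹ σ) w v
sub σ (ν w)   (ν v)   = ν sub (lift σ) w v

infixr 7 _⊙_
_⊙_ : Word a l n → Word a m l → Word a m n
_⊙_ = sub id

▹-cong : ∀ {A : Set} {x : A} {σ τ : Fin a → A} → σ ≗ τ → x ▹ σ ≗ x ▹ τ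
▹-cong σ≗τ zero    = refl
▹-cong σ≗τ (suc i) = σ≗τ i

sub-cong : {σ τ : Fin a → Fin b} → σ ≗ τ → (w : Word a l n) (v : Word b m l) →
           sub σ w v ≡ sub τ w v
sub-cong σ≗τ []      []      = refl
sub-cong σ≗τ (x ∷ w) v       = cong₂ _∷_ (σ≗τ x) (sub-cong σ≗τ w v)
sub-cong σ≗τ (ν w)   (x ∷ v) = cong (x ∷_) (sub-cong (▹-cong σ≗τ) w v)
sub-cong σ≗τ (ν w)   (ν v)   =
  cong ν_ (sub-cong (▹-cong (cong suc ∘ σ≗τ)) w v)

∘-▹ : ∀ {A B : Set} (f : A → B) x (σ : Fin a → A) → f ∘ (x ▹ σ) ≗ f x ▹ (f ∘ σ)
∘-▹ f x σ zero    = refl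
∘-▹ f x σ (suc i) = refl

▹-∘-lift : ∀ {A : Set} (x : A) (σ : Fin b → A) (τ : Fin a → Fin b) →
           (x ▹ σ) ∘ lift τ ≗ x ▹ (σ ∘ τ)
▹-∘-lift x σ τ zero    = refl
▹-∘-lift x σ τ (suc i) = refl

lift-∘ : (σ : Fin b → Fin c) (τ : Fin a → Fin b) → lift σ ∘ lift τ ≗ lift (σ ∘ τ)
lift-∘ σ τ zero    = refl
lift-∘ σ τ (suc i) = refl

-- For identities this is associativity of `⊙`. The renamings are arbitrary because every `ν` that
-- is passed extends them.
sub-sub : (σ : Fin b → Fin c) (τ : Fin a → Fin b)
          (w : Word a l n) (u : Word b m l) (v : Word c p m) →
          sub σ (sub τ w u) v ≡ sub (σ ∘ τ) w (sub σ u v)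
sub-sub σ τ []      []      []      = refl
sub-sub σ τ (x ∷ w) u       v       = cong (σ (τ x) ∷_) (sub-sub σ τ w u v)
sub-sub σ τ (ν w)   (x ∷ u) v       = cong (σ x ∷_)
  (trans (sub-sub σ (x ▹ τ) w u v) (sub-cong (∘-▹ σ x τ) w _))
sub-sub σ τ (ν w)   (ν u)   (x ∷ v) = cong (x ∷_)
  (trans (sub-sub (x ▹ σ) (lift τ) w u v) (sub-cong (▹-∘-lift x σ τ) w _))
sub-sub σ τ (ν w)   (ν u)   (ν v)   = cong ν_
  (trans (sub-sub (lift σ) (lift τ) w u v) (sub-cong (lift-∘ σ τ) w _))

params : ∀ m → Word a m m
params zero    = []
params (suc m) = ν params m

sub-params : (σ : Fin a → Fin b) (v : Word b m l) → sub σ (params l) v ≡ v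
sub-params σ []      = refl
sub-params σ (x ∷ v) = cong (x ∷_) (sub-params (x ▹ σ) v)
sub-params σ (ν v)   = cong ν_ (sub-params (lift σ) v)

-- Renaming is substitution of the identity word, which makes its laws instances of `sub-sub`.
ren : (Fin a → Fin b) → Word a m n → Word b m n
ren ρ w = sub ρ w (params _)

sub-ren : (σ : Fin b → Fin c) (ρ : Fin a → Fin b) (w : Word a l n) (v : Word c m l) →
          sub σ (ren ρ w) v ≡ sub (σ ∘ ρ) w v
sub-ren σ ρ w v =
  trans (sub-sub σ ρ w (params _) v) (cong (sub (σ ∘ ρ) w) (sub-params σ v))

-- Finite spaces of colourings, themselves used as sets of colours.

toCode : Word b 0 n → Fin (b ^ n)
toCode []      = zero
toCode (x ∷ w) = combine x (toCode w)

fromCode : ∀ n → Fin (b ^ n) → Word b 0 n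
fromCode         zero    _ = []
fromCode {b = b} (suc n) i =
  proj₁ (remQuot {b} (b ^ n) i) ∷ fromCode n (proj₂ (remQuot {b} (b ^ n) i))

fromCode-toCode : (w : Word b 0 n) → fromCode n (toCode w) ≡ w
fromCode-toCode []      = refl
fromCode-toCode (x ∷ w) = trans
  (cong (λ (y , i) → y ∷ fromCode _ i) (Fin.remQuot-combine x (toCode w)))
  (cong (x ∷_) (fromCode-toCode w))

encode : (Word b 0 n → Fin k) → Fin (k ^ (b ^ n))
encode χ = funToFin (χ ∘ fromCode _)

funToFin-injective : (f g : Fin m → Fin n) → funToFin f ≡ funToFin g → f ≗ g
funToFin-injective f g eq i = begin
  f i                     ≡⟨ Fin.finToFun-funToFin f i ⟨
  finToFun (funToFin f) i ≡⟨ cong (λ e → finToFun e i) eq ⟩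
  finToFun (funToFin g) i ≡⟨ Fin.finToFun-funToFin g i ⟩
  g i                     ∎
  where open ≡-Reasoning

encode-injective : (χ ψ : Word b 0 n → Fin k) → encode χ ≡ encode ψ → χ ≗ ψ
encode-injective χ ψ eq w = begin
  χ w                       ≡⟨ cong χ (fromCode-toCode w) ⟨
  χ (fromCode _ (toCode w)) ≡⟨ funToFin-injective (χ ∘ fromCode _) (ψ ∘ fromCode _)
                                 eq (toCode w) ⟩
  ψ (fromCode _ (toCode w)) ≡⟨ cong ψ (fromCode-toCode w) ⟩
  ψ w                       ∎
  where open ≡-Reasoning

-- The Hales–Jewett theorem, after Shelah

-- x … x y … y w, with i letters x and N − i letters y
block : (x y : Fin a) (N : ℕ) → Fin (suc N) → Word a m n → Word a m (N + n)
block x y zero    zero    w = w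
block x y (suc N) zero    w = y ∷ block x y N zero w
block x y (suc N) (suc i) w = x ∷ block x y N i w

-- x … x z … z y … y w, with i letters x and j − i letters z; in line, the
-- letter z is a new parameter.
lineAt : (z x y : Fin a) (N : ℕ) (i j : Fin (suc N)) → i Fin.< j →
         Word a m n → Word a m (N + n)
lineAt z x y (suc N) zero    (suc j) i<j w = z ∷ block z y N j w
lineAt z x y (suc N) (suc i) (suc j) i<j w = x ∷ lineAt z x y N i j (s<s⁻¹ i<j) w

line : (x y : Fin a) (N : ℕ) (i j : Fin (suc N)) → i Fin.< j →
       Word (suc a) m n → Word a (suc m) (N + n)
line x y (suc N) zero    (suc j) i<j w = ν block zero (suc y) N j w
line x y (suc N) (suc i) (suc j) i<j w = x ∷ line x y N i j (s<s⁻¹ i<j) w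

sub-block : ∀ (σ : Fin a → Fin b) x y N i (w : Word a l n) (v : Word b m l) →
            sub σ (block x y N i w) v ≡ block (σ x) (σ y) N i (sub σ w v)
sub-block σ x y zero    zero    w v = refl
sub-block σ x y (suc N) zero    w v = cong (σ y ∷_) (sub-block σ x y N zero w v)
sub-block σ x y (suc N) (suc i) w v = cong (σ x ∷_) (sub-block σ x y N i w v)

sub-line : ∀ (σ : Fin a → Fin b) x y N i j i<j (w : Word (suc a) l n) z (v : Word b m l) →
           sub σ (line x y N i j i<j w) (z ∷ v) ≡
           lineAt z (σ x) (σ y) N i j i<j (sub (z ▹ σ) w v)
sub-line σ x y (suc N) zero    (suc j) i<j w z v =
  cong (z ∷_) (sub-block (z ▹ σ) zero (suc y) N j w v)
sub-line σ x y (suc N) (suc i) (suc j) i<j w z v =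
  cong (σ x ∷_) (sub-line σ x y N i j (s<s⁻¹ i<j) w z v)

block-const : ∀ (x y : Fin a) N i (w : Word a m n) →
              block y y N i w ≡ block x y N zero w
block-const x y zero    zero    w = refl
block-const x y (suc N) zero    w = cong (y ∷_) (block-const x y N zero w)
block-const x y (suc N) (suc i) w = cong (y ∷_) (block-const x y N i w)

lineAt-left : ∀ (x y : Fin a) N i j i<j (w : Word a m n) →
              lineAt x x y N i j i<j w ≡ block x y N j w
lineAt-left x y (suc N) zero    (suc j) i<j w = refl
lineAt-left x y (suc N) (suc i) (suc j) i<j w =
  cong (x ∷_) (lineAt-left x y N i j (s<s⁻¹ i<j) w)

lineAt-right : ∀ (x y : Fin a) N i j i<j (w : Word a m n) →
               lineAt y x y N i j i<j w ≡ block x y N i w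
lineAt-right x y (suc N) zero    (suc j) i<j w = cong (y ∷_) (block-const x y N j w)
lineAt-right x y (suc N) (suc i) (suc j) i<j w =
  cong (x ∷_) (lineAt-right x y N i j (s<s⁻¹ i<j) w)

-- Followed by `suc`, this replaces the letter 0 by 1 and fixes all others.
merge : Fin (suc (suc a)) → Fin (suc a)
merge zero    = zero
merge (suc i) = i

-- By pigeonhole some two of the blocks 0ⁱ1…1 have the same colour whatever
-- follows them; between them runs a line on which 0 and 1 may be exchanged.
insensitive : ∀ a p k → ∃ λ n → (χ : Word (suc (suc a)) 0 n → Fin k) →
              Σ (Word (suc (suc a)) p n) λ w →
              ∀ v → χ (w ⊙ v) ≡ χ (w ⊙ ren (suc ∘ merge) v)
insensitive a zero    k = 0 , λ χ → [] , λ { [] → refl }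
insensitive a (suc p) k = q + r , go
  where
  A = suc (suc a)
  -- The tail is coloured by the whole function from the letter put on the line to the resulting
  -- colour, hence `k ^ A` colours.
  r = proj₁ (insensitive a p (k ^ A))
  -- The number of colourings of the words of length `r`: two of the `q + 1` blocks must induce the
  -- same one.
  q = k ^ (A ^ r)

  go : (χ : Word A 0 (q + r) → Fin k) → Σ (Word A (suc p) (q + r)) λ w →
       ∀ v → χ (w ⊙ v) ≡ χ (w ⊙ ren (suc ∘ merge) v)
  go χ with Fin.pigeonhole (ℕ.n<1+n q) (λ i → encode (χ ∘ block zero (suc zero) q i))
  ... | i , j , i<j , eq
    with proj₂ (insensitive a p (k ^ A))
           (λ u → funToFin λ z → χ (lineAt z zero (suc zero) q i j i<j u))
  ... | w , w-ins = L , ins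
    where
    open ≡-Reasoning
    at : Fin A → Word A 0 r → Word A 0 (q + r)
    at z = lineAt z zero (suc zero) q i j i<j

    L = line zero (suc zero) q i j i<j (ren suc w)

    L-at : ∀ z v → L ⊙ (z ∷ v) ≡ at z (w ⊙ v)
    L-at z v = trans (sub-line id zero (suc zero) q i j i<j (ren suc w) z v)
                     (cong (at z) (sub-ren (z ▹ id) suc w v))

    exchange : ∀ z u → χ (at z u) ≡ χ (at (suc (merge z)) u)
    exchange (suc z) u = refl
    exchange zero    u = begin
      χ (at zero u)                    ≡⟨ cong χ (lineAt-left zero (suc zero) q i j i<j u) ⟩
      χ (block zero (suc zero) q j u)  ≡⟨ encode-injective _ _ eq u ⟨
      χ (block zero (suc zero) q i u)  ≡⟨ cong χ (lineAt-right zero (suc zero) q i j i<j u) ⟨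
      χ (at (suc zero) u)              ∎

    ins : ∀ v → χ (L ⊙ v) ≡ χ (L ⊙ ren (suc ∘ merge) v)
    ins (z ∷ v) = begin
      χ (L ⊙ (z ∷ v))
        ≡⟨ cong χ (L-at z v) ⟩
      χ (at z (w ⊙ v))
        ≡⟨ funToFin-injective (λ y → χ (at y _)) (λ y → χ (at y _)) (w-ins v) z ⟩
      χ (at z (w ⊙ ren (suc ∘ merge) v))
        ≡⟨ exchange z _ ⟩
      χ (at (suc (merge z)) (w ⊙ ren (suc ∘ merge) v))
        ≡⟨ cong χ (L-at (suc (merge z)) (ren (suc ∘ merge) v)) ⟨
      χ (L ⊙ ren (suc ∘ merge) (z ∷ v)) ∎

-- The argument `Fin k` supplies a colour where no word provides one, as when `m > l` and there is
-- no `v`.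
GrahamRothschild : ℕ → Set
GrahamRothschild m = ∀ k a l → ∃ λ n → (χ : Word (suc a) m n → Fin k) → Fin k →
  Σ (Word (suc a) l n) λ w → ∃ λ x → ∀ v → χ (w ⊙ v) ≡ x

unary-unique : (v w : Word 1 0 n) → v ≡ w
unary-unique []         []         = refl
unary-unique (zero ∷ v) (zero ∷ w) = cong (zero ∷_) (unary-unique v w)

constant : Fin a → ∀ n → Word a 0 n
constant x zero    = []
constant x (suc n) = x ∷ constant x n

-- Induction on the alphabet: inside a word from `insensitive` the letter 0 may be replaced by 1, so
-- only the colours of words avoiding 0 matter, and these use one letter less.
hales-jewett : GrahamRothschild 0
hales-jewett k zero    l = l , λ χ _ →
  params l , χ (params l ⊙ constant zero l) ,
  λ v → cong (λ u → χ (params l ⊙ u)) (unary-unique v _)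
hales-jewett k (suc a) l = proj₁ (insensitive a q k) , go
  where
  q = proj₁ (hales-jewett k a l)

  go : (χ : Word (suc (suc a)) 0 _ → Fin k) → Fin k →
       Σ (Word (suc (suc a)) l _) λ w → ∃ λ x → ∀ v → χ (w ⊙ v) ≡ x
  go χ d with proj₂ (insensitive a q k) χ
  ... | w , ins with proj₂ (hales-jewett k a l) (λ u → χ (w ⊙ ren suc u)) d
  ... | u , x , mono = w ⊙ ren suc u , x , λ v → begin
    χ ((w ⊙ ren suc u) ⊙ v)                         ≡⟨ cong χ (sub-sub id id w _ v) ⟩
    χ (w ⊙ ren suc u ⊙ v)                           ≡⟨ ins _ ⟩
    χ (w ⊙ ren (suc ∘ merge) (ren suc u ⊙ v))       ≡⟨ cong (λ t → χ (w ⊙ t)) (collapse u v) ⟩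
    χ (w ⊙ ren suc (u ⊙ ren merge v))               ≡⟨ mono (ren merge v) ⟩
    x                                               ∎
    where
    open ≡-Reasoning
    collapse : (u : Word (suc a) l q) (v : Word (suc (suc a)) 0 l) →
               ren (suc ∘ merge) (ren suc u ⊙ v) ≡ ren suc (u ⊙ ren merge v)
    collapse u v = begin
      ren (suc ∘ merge) (ren suc u ⊙ v)
        ≡⟨ sub-sub (suc ∘ merge) id (ren suc u) v [] ⟩
      sub (suc ∘ merge) (ren suc u) (ren (suc ∘ merge) v)
        ≡⟨ sub-ren (suc ∘ merge) suc u _ ⟩
      sub suc u (ren (suc ∘ merge) v)
        ≡⟨ cong (sub suc u) (sub-sub suc merge v [] []) ⟨
      sub suc u (ren suc (ren merge v))
        ≡⟨ sub-sub suc id u (ren merge v) [] ⟨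
      ren suc (u ⊙ ren merge v) ∎

-- The induction step of the Graham-Rothschild theorem

-- Words with a parameter are coloured through their prefix, the letters before
-- the first parameter.

prefix : Word a (suc m) n → List (Fin a)
prefix (x ∷ w) = x ∷ prefix w
prefix (ν w)   = []

-- sub, with the parameters beyond the given letters cut off
trunc : (Fin a → Fin b) → Word a m n → List (Fin b) → List (Fin b)
trunc σ []      xs       = []
trunc σ (y ∷ w) xs       = σ y ∷ trunc σ w xs
trunc σ (ν w)   []       = []
trunc σ (ν w)   (x ∷ xs) = x ∷ trunc (x ▹ σ) w xs

prefix-sub : (σ : Fin a → Fin b) (w : Word a l n) (v : Word b (suc m) l) →
             prefix (sub σ w v) ≡ trunc σ w (prefix v)
prefix-sub σ (y ∷ w) v       = cong (σ y ∷_) (prefix-sub σ w v)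
prefix-sub σ (ν w)   (x ∷ v) = cong (x ∷_) (prefix-sub (x ▹ σ) w v)
prefix-sub σ (ν w)   (ν v)   = refl

trunc-cong : {σ τ : Fin a → Fin b} → σ ≗ τ → (w : Word a m n) → trunc σ w ≗ trunc τ w
trunc-cong σ≗τ []      xs       = refl
trunc-cong σ≗τ (y ∷ w) xs       = cong₂ _∷_ (σ≗τ y) (trunc-cong σ≗τ w xs)
trunc-cong σ≗τ (ν w)   []       = refl
trunc-cong σ≗τ (ν w)   (x ∷ xs) = cong (x ∷_) (trunc-cong (▹-cong σ≗τ) w xs)

trunc-sub : (σ : Fin b → Fin c) (τ : Fin a → Fin b) (w : Word a l n) (u : Word b m l) →
            trunc σ (sub τ w u) ≗ trunc (σ ∘ τ) w ∘ trunc σ u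
trunc-sub σ τ []      []      xs       = refl
trunc-sub σ τ (y ∷ w) u       xs       = cong (σ (τ y) ∷_) (trunc-sub σ τ w u xs)
trunc-sub σ τ (ν w)   (y ∷ u) xs       = cong (σ y ∷_)
  (trans (trunc-sub σ (y ▹ τ) w u xs) (trunc-cong (∘-▹ σ y τ) w _))
trunc-sub σ τ (ν w)   (ν u)   []       = refl
trunc-sub σ τ (ν w)   (ν u)   (x ∷ xs) = cong (x ∷_)
  (trans (trunc-sub (x ▹ σ) (lift τ) w u xs) (trunc-cong (▹-∘-lift x σ τ) w _))

-- A `v` with empty prefix is `ν` followed by a word with `m` parameters over one letter more, where
-- the hypothesis for `m` makes the colour constant. The words that begin with a letter fall to the
-- recursion on `p`, which treats all first letters at once by taking functions from letters to
-- colours as its colours.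
prefix-dependent : GrahamRothschild m → ∀ p k a →
  ∃ λ n → (χ : Word (suc a) (suc m) n → Fin k) → Fin k →
  Σ (Word (suc a) p n) λ w → ∃ λ (f : List (Fin (suc a)) → Fin k) →
  ∀ v → χ (w ⊙ v) ≡ f (prefix v)
prefix-dependent     gr zero    k a = 0 , λ _ d → [] , (λ _ → d) , λ ()
prefix-dependent {m} gr (suc p) k a = suc r , go
  where
  q = proj₁ (prefix-dependent gr p (k ^ suc a) a)
  r = proj₁ (gr k (suc a) q)

  go : (χ : Word (suc a) (suc m) (suc r) → Fin k) → Fin k →
       Σ (Word (suc a) (suc p) (suc r)) λ w → ∃ λ (f : List (Fin (suc a)) → Fin k) →
       ∀ v → χ (w ⊙ v) ≡ f (prefix v)
  go χ d with proj₂ (gr k (suc a) q) (λ u → χ (ν u)) d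
  ... | w₁ , x , mono
    with proj₂ (prefix-dependent gr p (k ^ suc a) a)
           (λ u → funToFin λ e → χ (e ∷ sub (e ▹ id) w₁ u)) (funToFin {suc a} λ _ → d)
  ... | w₂ , f₂ , dep = ν w , f , correct
    where
    open ≡-Reasoning
    w = w₁ ⊙ ren suc w₂

    f : List (Fin (suc a)) → Fin k
    f []       = x
    f (e ∷ es) = finToFun (f₂ es) e

    lift-id : lift {a = suc a} id ≗ id
    lift-id zero    = refl
    lift-id (suc i) = refl

    correct : ∀ v → χ ((ν w) ⊙ v) ≡ f (prefix v)
    correct (ν v)   = begin
      χ (ν sub (lift id) w v)             ≡⟨ cong (λ u → χ (ν u)) (sub-cong lift-id w v) ⟩
      χ (ν w ⊙ v)                         ≡⟨ cong (λ u → χ (ν u)) (sub-sub id id w₁ _ v) ⟩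
      χ (ν (w₁ ⊙ ren suc w₂ ⊙ v))         ≡⟨ mono _ ⟩
      x                                   ∎
    correct (e ∷ v) = begin
      χ (e ∷ sub (e ▹ id) w v)
        ≡⟨ cong (λ u → χ (e ∷ u)) (sub-sub (e ▹ id) id w₁ _ v) ⟩
      χ (e ∷ sub (e ▹ id) w₁ (sub (e ▹ id) (ren suc w₂) v))
        ≡⟨ cong (λ u → χ (e ∷ sub (e ▹ id) w₁ u)) (sub-ren (e ▹ id) suc w₂ v) ⟩
      χ (e ∷ sub (e ▹ id) w₁ (w₂ ⊙ v))
        ≡⟨ Fin.finToFun-funToFin (λ e → χ (e ∷ sub (e ▹ id) w₁ (w₂ ⊙ v))) e ⟨
      finToFun (funToFin λ e → χ (e ∷ sub (e ▹ id) w₁ (w₂ ⊙ v))) e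
        ≡⟨ cong (λ h → finToFun h e) (dep v) ⟩
      finToFun (f₂ (prefix v)) e ∎

-- A parameter at the very end leaves the truncations at lists of length at most `m` unchanged. It
-- lets lists of length exactly `m`, which fill all of `w`, count as too short for the enlarged
-- word.
snoc : Word a m n → Word a (suc m) (suc n)
snoc []      = ν []
snoc (x ∷ w) = x ∷ snoc w
snoc (ν w)   = ν snoc w

trunc-snoc : ∀ (σ : Fin a → Fin b) (w : Word a m n) xs → length xs ℕ.≤ m →
             trunc σ (snoc w) xs ≡ trunc σ w xs
trunc-snoc σ []      []       _  = refl
trunc-snoc σ (y ∷ w) xs       le = cong (σ y ∷_) (trunc-snoc σ w xs le)
trunc-snoc σ (ν w)   []       _  = refl
trunc-snoc σ (ν w)   (x ∷ xs) le = cong (x ∷_) (trunc-snoc (x ▹ σ) w xs (s≤s⁻¹ le))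

letters : Word a 0 n → List (Fin a)
letters []      = []
letters (x ∷ w) = x ∷ letters w

fromLetters : (xs : List (Fin a)) → Word a 0 (length xs)
fromLetters []       = []
fromLetters (x ∷ xs) = x ∷ fromLetters xs

letters-fromLetters : (xs : List (Fin a)) → letters (fromLetters xs) ≡ xs
letters-fromLetters []       = refl
letters-fromLetters (x ∷ xs) = cong (x ∷_) (letters-fromLetters xs)

trunc-letters : (σ : Fin a → Fin b) (w : Word a l n) (v : Word b 0 l) →
                trunc σ w (letters v) ≡ letters (sub σ w v)
trunc-letters σ []      []      = refl
trunc-letters σ (y ∷ w) v       = cong (σ y ∷_) (trunc-letters σ w v)
trunc-letters σ (ν w)   (x ∷ v) = cong (x ∷_) (trunc-letters (x ▹ σ) w v)

-- The greatest length `t` is settled by Hales-Jewett, since a list of that length leaves no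
-- parameter of `w₁ ⊙ w₂` open. Constancy on full words survives the further substitution of `w₂`,
-- which recursion chooses for the shorter lists.
length-dependent : ∀ t k a → ∃ λ p → (f : List (Fin (suc a)) → Fin k) → Fin k →
  Σ (Word (suc a) t p) λ w → ∃ λ (g : ℕ → Fin k) →
  ∀ xs → length xs ℕ.< t → f (trunc id w xs) ≡ g (length xs)
length-dependent zero    k a = 0 , λ f d → [] , (λ _ → d) , λ _ ()
length-dependent (suc t) k a = suc r , go
  where
  q = proj₁ (length-dependent t k a)
  r = proj₁ (hales-jewett k a q)

  go : (f : List (Fin (suc a)) → Fin k) → Fin k →
       Σ (Word (suc a) (suc t) (suc r)) λ w → ∃ λ (g : ℕ → Fin k) →
       ∀ xs → length xs ℕ.< suc t → f (trunc id w xs) ≡ g (length xs)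
  go f d with proj₂ (hales-jewett k a q) (f ∘ letters) d
  ... | w₁ , x , mono
    with proj₂ (length-dependent t k a) (f ∘ trunc id w₁) d
  ... | w₂ , g₂ , dep = snoc (w₁ ⊙ w₂) , g , correct
    where
    open ≡-Reasoning
    g : ℕ → Fin k
    g i with i ℕ.≟ t
    ... | yes _ = x
    ... | no  _ = g₂ i

    full : ∀ {t} (w₂ : Word (suc a) t q) xs → length xs ≡ t →
           f (trunc id w₁ (trunc id w₂ xs)) ≡ x
    full w₂ xs refl = begin
      f (trunc id w₁ (trunc id w₂ xs))
        ≡⟨ cong (λ ys → f (trunc id w₁ (trunc id w₂ ys))) (letters-fromLetters xs) ⟨
      f (trunc id w₁ (trunc id w₂ (letters (fromLetters xs))))
        ≡⟨ cong (f ∘ trunc id w₁) (trunc-letters id w₂ _) ⟩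
      f (trunc id w₁ (letters (w₂ ⊙ fromLetters xs)))
        ≡⟨ cong f (trunc-letters id w₁ _) ⟩
      f (letters (w₁ ⊙ w₂ ⊙ fromLetters xs))
        ≡⟨ mono _ ⟩
      x ∎

    correct : ∀ xs → length xs ℕ.< suc t →
              f (trunc id (snoc (w₁ ⊙ w₂)) xs) ≡ g (length xs)
    correct xs lt = begin
      f (trunc id (snoc (w₁ ⊙ w₂)) xs)  ≡⟨ cong f (trunc-snoc id (w₁ ⊙ w₂) xs (s≤s⁻¹ lt)) ⟩
      f (trunc id (w₁ ⊙ w₂) xs)         ≡⟨ cong f (trunc-sub id id w₁ w₂ xs) ⟩
      f (trunc id w₁ (trunc id w₂ xs))  ≡⟨ by-length ⟩
      g (length xs)                     ∎
      where
      by-length : f (trunc id w₁ (trunc id w₂ xs)) ≡ g (length xs)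
      by-length with length xs ℕ.≟ t
      ... | yes eq = full w₂ xs eq
      ... | no neq = dep xs (ℕ.≤∧≢⇒< (s≤s⁻¹ lt) neq)

-- The index in w at which its parameter number i is introduced
position : Word a m n → ℕ → ℕ
position []      i       = 0
position (x ∷ w) i       = suc (position w i)
position (ν w)   zero    = 0
position (ν w)   (suc i) = suc (position w i)

length-trunc : (σ : Fin a → Fin b) (w : Word a m n) (xs : List (Fin b)) →
               length (trunc σ w xs) ≡ position w (length xs)
length-trunc σ []      xs       = refl
length-trunc σ (y ∷ w) xs       = cong suc (length-trunc σ w xs)
length-trunc σ (ν w)   []       = refl
length-trunc σ (ν w)   (x ∷ xs) = cong suc (length-trunc (x ▹ σ) w xs)

position-< : ∀ (w : Word a m n) {i} → i ℕ.< m → position w i ℕ.< n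
position-< (x ∷ w)         i<m = s<s (position-< w i<m)
position-< (ν w) {zero}    i<m = z<s
position-< (ν w) {suc i}   i<m = s<s (position-< w (s<s⁻¹ i<m))

position-sub : (τ : Fin a → Fin b) (w : Word a l n) (u : Word b m l) →
               position (sub τ w u) ≗ position w ∘ position u
position-sub τ []      []      i       = refl
position-sub τ (y ∷ w) u       i       = cong suc (position-sub τ w u i)
position-sub τ (ν w)   (y ∷ u) i       = cong suc (position-sub (y ▹ τ) w u i)
position-sub τ (ν w)   (ν u)   zero    = refl
position-sub τ (ν w)   (ν u)   (suc i) = cong suc (position-sub (lift τ) w u i)

position-ren : (ρ : Fin a → Fin b) (w : Word a m n) → position (ren ρ w) ≗ position w
position-ren ρ []      i       = refl
position-ren ρ (x ∷ w) i       = cong suc (position-ren ρ w i)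
position-ren ρ (ν w)   zero    = refl
position-ren ρ (ν w)   (suc i) = cong suc (position-ren (lift ρ) w i)

-- The letter zero is put at the positions that are not selected.
select : ∀ a l m {n} → n ≡ l + m → {P : ℕ → Set} → (∀ i → Dec (P i)) →
         (Σ (Word (suc a) l n) λ w → ∀ i → i ℕ.< l → P (position w i)) ⊎
         (Σ (Word (suc a) m n) λ w → ∀ i → i ℕ.< m → ¬ P (position w i))
select a zero    m       refl P? = inj₁ (constant zero _ , λ _ ())
select a (suc l) zero    refl P? = inj₂ (constant zero _ , λ _ ())
select a (suc l) (suc m) refl {P} P? with P? 0
... | yes p with select a l (suc m) refl (P? ∘ suc)
...   | inj₂ (w , h) = inj₂ (zero ∷ w , h)
...   | inj₁ (w , h) = inj₁ (ν ren suc w , λ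
  { zero    _  → p
  ; (suc i) lt → subst (P ∘ suc) (sym (position-ren suc w i)) (h i (s<s⁻¹ lt)) })
select a (suc l) (suc m) refl {P} P? | no ¬p with select a (suc l) m (ℕ.+-suc l m) (P? ∘ suc)
...   | inj₁ (w , h) = inj₁ (zero ∷ w , h)
...   | inj₂ (w , h) = inj₂ (ν ren suc w , λ
  { zero    _  → ¬p
  ; (suc i) lt → subst (¬_ ∘ P ∘ suc) (sym (position-ren suc w i)) (h i (s<s⁻¹ lt)) })

-- Induction on the number of values: either `l` positions take the greatest value, or enough
-- positions avoid it. The chosen positions are given by a word so that passing to them is a
-- substitution.
pigeonhole-positions : ∀ a l k → ∃ λ t → (g : ℕ → ℕ) → (∀ i → i ℕ.< t → g i ℕ.< k) →
  Σ (Word (suc a) l t) λ w → ∃ λ x → ∀ i → i ℕ.< l → g (position w i) ≡ x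
-- Length 1 is chosen so that the bound on `g` already fails at 0.
pigeonhole-positions a l zero    = 1 , λ g g< → contradiction (g< 0 z<s) λ ()
pigeonhole-positions a l (suc k) = l + q , go
  where
  q = proj₁ (pigeonhole-positions a l k)

  go : (g : ℕ → ℕ) → (∀ i → i ℕ.< l + q → g i ℕ.< suc k) →
       Σ (Word (suc a) l (l + q)) λ w → ∃ λ x → ∀ i → i ℕ.< l → g (position w i) ≡ x
  go g g< with select a l q refl (λ i → g i ℕ.≟ k)
  ... | inj₁ (w , h) = w , k , h
  ... | inj₂ (u , h)
    with proj₂ (pigeonhole-positions a l k) (g ∘ position u)
           (λ i i<q → ℕ.≤∧≢⇒< (s≤s⁻¹ (g< _ (position-< u i<q))) (h i i<q))
  ... | w , x , mono = u ⊙ w , x , λ i i<l →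
    trans (cong g (position-sub id u w i)) (mono i i<l)

prefix-< : (v : Word a (suc m) n) → length (prefix v) ℕ.< n
prefix-< (x ∷ v) = s<s (prefix-< v)
prefix-< (ν v)   = z<s

-- Once the colour depends only on the prefix length, it remains to control the lengths that occur:
-- the prefix of `u ⊙ v` ends at the position in `u` of parameter number `length (prefix v)`, and
-- `u` can be chosen with all these positions of one colour.
graham-rothschild : ∀ m → GrahamRothschild m
graham-rothschild zero    = hales-jewett
graham-rothschild (suc m) k a l =
  proj₁ (prefix-dependent (graham-rothschild m) q k a) , go
  where
  t = proj₁ (pigeonhole-positions a l k)
  q = proj₁ (length-dependent t k a)

  go : (χ : Word (suc a) (suc m) _ → Fin k) → Fin k →
       Σ (Word (suc a) l _) λ w → ∃ λ x → ∀ v → χ (w ⊙ v) ≡ x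
  go χ d with proj₂ (prefix-dependent (graham-rothschild m) q k a) χ d
  ... | w , f , χ≡f with proj₂ (length-dependent t k a) f d
  ... | w′ , g , f≡g
    with proj₂ (pigeonhole-positions a l k) (toℕ ∘ g) (λ i _ → Fin.toℕ<n (g i))
  -- Parameter 0 can represent all the others because any `v` contains a parameter, which forces
  -- `0 < l`.
  ... | u , x , g≡x = w ⊙ w′ ⊙ u , g (position u 0) , λ v →
    let i   = length (prefix v)
        i<l = prefix-< v
    in begin
    χ ((w ⊙ w′ ⊙ u) ⊙ v)                ≡⟨ cong χ (sub-sub id id w (w′ ⊙ u) v) ⟩
    χ (w ⊙ (w′ ⊙ u) ⊙ v)                ≡⟨ cong (λ y → χ (w ⊙ y)) (sub-sub id id w′ u v) ⟩
    χ (w ⊙ w′ ⊙ u ⊙ v)                  ≡⟨ χ≡f (w′ ⊙ u ⊙ v) ⟩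
    f (prefix (w′ ⊙ u ⊙ v))             ≡⟨ cong f (prefix-sub id w′ (u ⊙ v)) ⟩
    f (trunc id w′ (prefix (u ⊙ v)))    ≡⟨ f≡g (prefix (u ⊙ v)) (prefix-< (u ⊙ v)) ⟩
    g (length (prefix (u ⊙ v)))         ≡⟨ cong (g ∘ length) (prefix-sub id u v) ⟩
    g (length (trunc id u (prefix v)))  ≡⟨ cong g (length-trunc id u (prefix v)) ⟩
    g (position u i)                    ≡⟨ Fin.toℕ-injective (trans (g≡x i i<l)
                                             (sym (g≡x 0 (ℕ.≤-<-trans z≤n i<l)))) ⟩
    g (position u 0)                    ∎
    where open ≡-Reasoning

-- Natural orders

indicator : ∀ {A : Set} → Dec A → ℕ
indicator A? = if does A? then 1 else 0

module _ {A B : Set} where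
  indicator-≡⇒ : (A? : Dec A) (B? : Dec B) → indicator A? ≡ indicator B? →
                 (A → B) × (B → A)
  indicator-≡⇒ (yes a) (yes b) _ = (λ _ → b) , (λ _ → a)
  indicator-≡⇒ (no ¬a) (no ¬b) _ = (λ a → contradiction a ¬a) , (λ b → contradiction b ¬b)

  ⇒indicator-≡ : (A? : Dec A) (B? : Dec B) → (A → B) × (B → A) →
                 indicator A? ≡ indicator B?
  ⇒indicator-≡ (yes _) (yes _) _       = refl
  ⇒indicator-≡ (no  _) (no  _) _       = refl
  ⇒indicator-≡ (yes a) (no ¬b) (f , _) = contradiction (f a) ¬b
  ⇒indicator-≡ (no ¬a) (yes b) (_ , g) = contradiction (g b) ¬a

  indicator-<⇒ : (A? : Dec A) (B? : Dec B) → indicator A? ℕ.< indicator B? → ¬ A × B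
  indicator-<⇒ (no ¬a) (yes b) _ = ¬a , b
  indicator-<⇒ (yes _) (yes _) (ℕ.s≤s ())

  ⇒indicator-< : (A? : Dec A) (B? : Dec B) → ¬ A × B → indicator A? ℕ.< indicator B?
  ⇒indicator-< (no  _) (yes _) _        = z<s
  ⇒indicator-< (yes a) _       (¬a , _) = contradiction a ¬a
  ⇒indicator-< (no  _) (no ¬b) (_ , b)  = contradiction b ¬b

module Irreducibles (L : FiniteDistributiveLattice) where
  open FiniteDistributiveLattice L
    renaming (refl to ≤-refl; trans to ≤-trans; reflexive to ≤-reflexive)

  -- Distributivity enters here: `j` is the join of its meets with `a` and `b`.
  irreducible-prime : ∀ {j a b} → JoinIrreducible j → j ≤ a ∨ b → j ≤ a ⊎ j ≤ b
  irreducible-prime {j} {a} {b} (_ , irr) j≤ with irr (j ∧ a) (j ∧ b)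
    (Eq.trans (antisym (∧-greatest ≤-refl j≤) (x∧y≤x j _)) (∧-distribˡ-∨ j a b))
  ... | inj₁ eq = inj₁ (≤-trans (≤-reflexive eq) (x∧y≤y j a))
  ... | inj₂ eq = inj₂ (≤-trans (≤-reflexive eq) (x∧y≤y j b))

  irreducible-≰𝟎 : ∀ {j} → JoinIrreducible j → ¬ j ≤ 𝟎
  irreducible-≰𝟎 (j≉𝟎 , _) j≤𝟎 = j≉𝟎 (antisym j≤𝟎 (minimum _))

  ≤-by-irreducibles : ∀ {x y} → (∀ {j} → JoinIrreducible j → j ≤ x → j ≤ y) → x ≤ y
  ≤-by-irreducibles {x} {y} h = go x (<-wellFounded x) ≤-refl
    where
    go : ∀ z → Acc _<_ z → z ≤ x → z ≤ y
    go z (acc rs) z≤x with irreducible⊎zero⊎splits z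
    ... | inj₁ irr        = h irr z≤x
    ... | inj₂ (inj₁ z≈𝟎) = ≤-trans (≤-reflexive z≈𝟎) (minimum y)
    ... | inj₂ (inj₂ (a , b , z≈a∨b , z≉a , z≉b)) = ≤-trans (≤-reflexive z≈a∨b)
      (∨-least (go a (rs (a≤z , z≉a ∘ Eq.sym)) (≤-trans a≤z z≤x))
               (go b (rs (b≤z , z≉b ∘ Eq.sym)) (≤-trans b≤z z≤x)))
      where
      a≤z = ≤-trans (x≤x∨y a b) (≤-reflexive (Eq.sym z≈a∨b))
      b≤z = ≤-trans (y≤x∨y a b) (≤-reflexive (Eq.sym z≈a∨b))

  elements-complete : ∀ x → ∃ λ y → y ∈ elements × y ≈ x
  elements-complete x =
    E.to (E.from x) , ∈-tabulate⁺ (E.from x) , E.strictlyInverseˡ x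
    where module E = Inverse enumeration

  Agree : J → Rel Carrier 0ℓ
  Agree (t , _) x y = (t ≤ x → t ≤ y) × (t ≤ y → t ≤ x)

  δ-agree : ∀ t {x y} → δ t x ≡ δ t y → Agree t x y
  δ-agree (t , _) = indicator-≡⇒ (t ≤? _) (t ≤? _)

  agree-δ : ∀ t {x y} → Agree t x y → δ t x ≡ δ t y
  agree-δ (t , _) = ⇒indicator-≡ (t ≤? _) (t ≤? _)

  Differ : J → Rel Carrier 0ℓ
  Differ (s , _) x y = ¬ s ≤ x × s ≤ y

  δ-differ : ∀ s {x y} → δ s x ℕ.< δ s y → Differ s x y
  δ-differ (s , _) = indicator-<⇒ (s ≤? _) (s ≤? _)

  differ-δ : ∀ s {x y} → Differ s x y → δ s x ℕ.< δ s y
  differ-δ (s , _) = ⇒indicator-< (s ≤? _) (s ≤? _)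

  module LinearExtension {_⊏⁰_ : Rel J 0ℓ} (ext : IsLinearExtension _⊏⁰_) where
    open IsLinearExtension ext
    private module O = IsStrictTotalOrder isStrictTotalOrder

    -- `Antilex` with comparisons of 0-1 coordinates replaced by propositions.
    _≺_ : Rel Carrier 0ℓ
    x ≺ y = ∃ λ s → Differ s x y × (∀ t → s ⊏⁰ t → Agree t x y)

    antilex⇒≺ : ∀ {x y} → Antilex _⊏⁰_ x y → x ≺ y
    antilex⇒≺ (s , lt , eq) = s , δ-differ s lt , λ t s⊏t → δ-agree t (eq t s⊏t)

    ≺⇒antilex : ∀ {x y} → x ≺ y → Antilex _⊏⁰_ x y
    ≺⇒antilex (s , d , ag) = s , differ-δ s d , λ t s⊏t → agree-δ t (ag t s⊏t)

    ≤⇒¬⊏⁰ : ∀ {s t : J} → proj₁ t ≤ proj₁ s → ¬ s ⊏⁰ t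
    ≤⇒¬⊏⁰ {s} {t} t≤s s⊏t with proj₁ t ≈? proj₁ s
    ... | yes t≈s = O.irrefl (Eq.sym t≈s) s⊏t
    ... | no  t≉s = O.irrefl {s} {s} Eq.refl (O.trans s⊏t (extends (t≤s , t≉s)))

    ≺-irrefl : ∀ {x y} → x ≈ y → ¬ x ≺ y
    ≺-irrefl x≈y (s , (s≰x , s≤y) , _) = s≰x (≤-trans s≤y (≤-reflexive (Eq.sym x≈y)))

    ≺-trans : ∀ {x y z} → x ≺ y → y ≺ z → x ≺ z
    ≺-trans (s , (s≰x , s≤y) , ag) (s′ , (s′≰y , s′≤z) , ag′) with O.compare s s′
    ... | tri< s⊏s′ _ _ = s′ , (s′≰y ∘ proj₁ (ag s′ s⊏s′) , s′≤z) , λ t s′⊏t →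
      let (f , g) = ag t (O.trans s⊏s′ s′⊏t) ; (f′ , g′) = ag′ t s′⊏t in f′ ∘ f , g ∘ g′
    ... | tri≈ _ s≈s′ _ =
      contradiction (≤-trans (≤-reflexive (Eq.sym s≈s′)) s≤y) s′≰y
    ... | tri> _ _ s′⊏s = s , (s≰x , proj₁ (ag′ s s′⊏s) s≤y) , λ t s⊏t →
      let (f , g) = ag t s⊏t ; (f′ , g′) = ag′ t (O.trans s′⊏s s⊏t) in f′ ∘ f , g ∘ g′

    module _ {P : Pred Carrier 0ℓ} (P? : Decidable P) where

      Greatest : List Carrier → J → Set
      Greatest xs s = P (proj₁ s) × All (λ x → ∀ irr → s ⊏⁰ (x , irr) → ¬ P x) xs

      -- Applied to the coordinates at which two elements differ, this finds the one that decides
      -- their antilexicographic comparison.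
      greatest : ∀ xs → All (λ x → JoinIrreducible x → ¬ P x) xs ⊎ ∃ (Greatest xs)
      greatest []       = inj₁ []
      greatest (x ∷ xs) with joinIrreducible? x | P? x | greatest xs
      ... | no ¬irr | _     | inj₁ none         =
        inj₁ ((λ irr → contradiction irr ¬irr) ∷ none)
      ... | no ¬irr | _     | inj₂ (s , ps , g) =
        inj₂ (s , ps , (λ irr → contradiction irr ¬irr) ∷ g)
      ... | yes _   | no ¬p | inj₁ none         = inj₁ ((λ _ → ¬p) ∷ none)
      ... | yes _   | no ¬p | inj₂ (s , ps , g) = inj₂ (s , ps , (λ _ _ → ¬p) ∷ g)
      ... | yes irr | yes p | inj₁ none         = inj₂ ((x , irr) , p ,
        (λ irr′ lt → contradiction lt (O.irrefl Eq.refl)) ∷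
        All.map (λ h irr′ _ → h irr′) none)
      ... | yes irr | yes p | inj₂ (s , ps , g) with O.compare s (x , irr)
      ...   | tri< s⊏x _ _ = inj₂ ((x , irr) , p ,
        (λ irr′ lt → contradiction lt (O.irrefl Eq.refl)) ∷
        All.map (λ h irr′ lt → h irr′ (O.trans s⊏x lt)) g)
      ...   | tri≈ _ s≈x _ = inj₂ (s , ps ,
        (λ irr′ lt → contradiction lt (O.irrefl s≈x)) ∷ g)
      ...   | tri> _ _ x⊏s = inj₂ (s , ps ,
        (λ irr′ lt → contradiction (O.trans (proj₁ O.<-resp-≈ Eq.refl lt) x⊏s)
                                  (O.irrefl Eq.refl)) ∷ g)

    private
      differ? : ∀ x y z → Dec (¬ z ≤ x × z ≤ y ⊎ ¬ z ≤ y × z ≤ x)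
      differ? x y z = (¬? (z ≤? x) ×-dec (z ≤? y)) ⊎-dec (¬? (z ≤? y) ×-dec (z ≤? x))

      agree : ∀ {x y z} → ¬ (¬ z ≤ x × z ≤ y ⊎ ¬ z ≤ y × z ≤ x) →
              (z ≤ x → z ≤ y) × (z ≤ y → z ≤ x)
      agree {x} {y} {z} ¬d =
        (λ z≤x → decidable-stable (z ≤? y) λ z≰y → ¬d (inj₂ (z≰y , z≤x))) ,
        (λ z≤y → decidable-stable (z ≤? x) λ z≰x → ¬d (inj₁ (z≰x , z≤y)))

      agree-resp : ∀ {x y z z′} → z ≈ z′ → (z ≤ x → z ≤ y) × (z ≤ y → z ≤ x) →
                   (z′ ≤ x → z′ ≤ y) × (z′ ≤ y → z′ ≤ x)
      agree-resp {x} {y} {z} {z′} eq (f , g) = to-z′ ∘ f ∘ to-z , to-z′ ∘ g ∘ to-z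
        where
        to-z : ∀ {u} → z′ ≤ u → z ≤ u
        to-z = ≤-trans (≤-reflexive eq)
        to-z′ : ∀ {u} → z ≤ u → z′ ≤ u
        to-z′ = ≤-trans (≤-reflexive (Eq.sym eq))

    ≺-compare : Trichotomous _≈_ _≺_
    ≺-compare x y with greatest (differ? x y) elements
    ... | inj₁ none = tri≈ (≺-irrefl x≈y) x≈y (≺-irrefl (Eq.sym x≈y))
      where
      agreeing : ∀ {j} → JoinIrreducible j → (j ≤ x → j ≤ y) × (j ≤ y → j ≤ x)
      agreeing {j} irr with elements-complete j
      ... | j′ , j′∈ , j′≈j = agree-resp j′≈j
        (agree (All.lookup none j′∈ (joinIrreducible-resp (Eq.sym j′≈j) irr)))
      x≈y : x ≈ y
      x≈y = antisym (≤-by-irreducibles (proj₁ ∘ agreeing))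
                    (≤-by-irreducibles (proj₂ ∘ agreeing))
    ... | inj₂ (s , ps , g) = result ps
      where
      agreeing : ∀ t → s ⊏⁰ t → Agree t x y
      agreeing (j , irr) s⊏j with elements-complete j
      ... | j′ , j′∈ , j′≈j = agree-resp j′≈j (agree (All.lookup g j′∈
        (joinIrreducible-resp (Eq.sym j′≈j) irr) (proj₁ O.<-resp-≈ (Eq.sym j′≈j) s⊏j)))
      result : _ → Tri (x ≺ y) (x ≈ y) (y ≺ x)
      result (inj₁ d) = tri< x≺y (λ x≈y → ≺-irrefl x≈y x≺y)
                             λ y≺x → ≺-irrefl Eq.refl (≺-trans x≺y y≺x)
        where x≺y = s , d , agreeing
      result (inj₂ d) = tri> (λ x≺y → ≺-irrefl Eq.refl (≺-trans x≺y y≺x))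
                             (λ x≈y → ≺-irrefl (Eq.sym x≈y) y≺x) y≺x
        where y≺x = s , d , λ t lt → swap (agreeing t lt)

    antilex-isStrictTotalOrder : IsStrictTotalOrder _≈_ (Antilex _⊏⁰_)
    antilex-isStrictTotalOrder = isStrictTotalOrderᶜ record
      { isEquivalence = isEquivalence
      ; trans         = λ p q → ≺⇒antilex (≺-trans (antilex⇒≺ p) (antilex⇒≺ q))
      ; compare       = compare
      }
      where
      compare : Trichotomous _≈_ (Antilex _⊏⁰_)
      compare x y with ≺-compare x y
      ... | tri< lt ¬eq ¬gt = tri< (≺⇒antilex lt) ¬eq (¬gt ∘ antilex⇒≺)
      ... | tri≈ ¬lt eq ¬gt = tri≈ (¬lt ∘ antilex⇒≺) eq (¬gt ∘ antilex⇒≺)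
      ... | tri> ¬lt ¬eq gt = tri> (¬lt ∘ antilex⇒≺) ¬eq (≺⇒antilex gt)

module _ (L K : FiniteDistributiveLattice) where
  private
    module L = FiniteDistributiveLattice L
    module K = FiniteDistributiveLattice K

  ≤-image-⋁ : ∀ {f} → IsBoundedLatticeHomomorphism L K f →
              ∀ {P : Pred L.Carrier 0ℓ} (P? : Decidable P) {s} → K.JoinIrreducible s →
              s K.≤ f (L.⋁ P?) → ∃ λ r → P r × s K.≤ f r
  ≤-image-⋁ {f} hom P? {s} irr s≤ with go (filter P? L.elements) s≤
    where
    open IsBoundedLatticeHomomorphism hom
    open Irreducibles K
    go : ∀ xs → s K.≤ f (foldr L._∨_ L.𝟎 xs) → ∃ λ r → r ∈ xs × s K.≤ f r
    go []       s≤ = contradiction (K.trans s≤ (K.reflexive 𝟎-homo)) (irreducible-≰𝟎 irr)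
    go (x ∷ xs) s≤ with irreducible-prime irr (K.trans s≤ (K.reflexive (∨-homo x _)))
    ... | inj₁ s≤fx = x , here refl , s≤fx
    ... | inj₂ s≤fr with go xs s≤fr
    ...   | r , r∈ , s≤fr = r , there r∈ , s≤fr
  ... | r , r∈ , s≤fr = r , proj₂ (∈-filter⁻ P? {xs = L.elements} r∈) , s≤fr

module Natural (L : NaturallyOrderedLattice) where
  open NaturallyOrderedLattice L hiding (refl; trans)
  open Irreducibles lattice public
  open IsNaturalOrder isNaturalOrder public using (_⊏⁰_; isLinearExtension; antilex)
  open LinearExtension isLinearExtension public
  open IsStrictTotalOrder isStrictTotalOrder public
    using ()
    renaming (irrefl to ⊏-irrefl; trans to ⊏-trans; compare to ⊏-compare; <-resp-≈ to ⊏-resp-≈)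
  open IsLinearExtension isLinearExtension public
    using () renaming (isStrictTotalOrder to ⊏⁰-isStrictTotalOrder)
  open IsStrictTotalOrder ⊏⁰-isStrictTotalOrder public
    using ()
    renaming (trans to ⊏⁰-trans; compare to ⊏⁰-compare; <-resp-≈ to ⊏⁰-resp-≈)

  ⊏⇒≺ : ∀ {x y} → x ⊏ y → x ≺ y
  ⊏⇒≺ x⊏y = antilex⇒≺ (Equivalence.to (antilex _ _) x⊏y)

  ≺⇒⊏ : ∀ {x y} → x ≺ y → x ⊏ y
  ≺⇒⊏ x≺y = Equivalence.from (antilex _ _) (≺⇒antilex x≺y)

  ⊑⇒⊐̸ : ∀ {x y} → x ⊑ y → ¬ y ⊏ x
  ⊑⇒⊐̸ (inj₁ x⊏y) y⊏x = ⊏-irrefl Eq.refl (⊏-trans x⊏y y⊏x)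
  ⊑⇒⊐̸ (inj₂ x≈y) y⊏x = ⊏-irrefl (Eq.sym x≈y) y⊏x

  ⊐̸⇒⊑ : ∀ {x y} → ¬ y ⊏ x → x ⊑ y
  ⊐̸⇒⊑ {x} {y} ¬y⊏x with ⊏-compare x y
  ... | tri< x⊏y _ _ = inj₁ x⊏y
  ... | tri≈ _ x≈y _ = inj₂ x≈y
  ... | tri> _ _ y⊏x = contradiction y⊏x ¬y⊏x

  ⊑-trans : ∀ {x y z} → x ⊑ y → y ⊑ z → x ⊑ z
  ⊑-trans p (inj₂ y≈z) = ⊑-resp Eq.refl y≈z p
  ⊑-trans (inj₂ x≈y) q = ⊑-resp (Eq.sym x≈y) Eq.refl q
  ⊑-trans (inj₁ p) (inj₁ q) = inj₁ (⊏-trans p q)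

  ≤⇒⊑ : ∀ {x y} → x ≤ y → x ⊑ y
  ≤⇒⊑ x≤y = ⊐̸⇒⊑ λ y⊏x → let (s , (s≰y , s≤x) , _) = ⊏⇒≺ y⊏x
                          in s≰y (NaturallyOrderedLattice.trans L s≤x x≤y)

-- Positivity in terms of join-irreducibles

module _ (L K : NaturallyOrderedLattice) where
  private
    module L where
      open NaturallyOrderedLattice L public
      open Natural L public
    module K where
      open NaturallyOrderedLattice K public
      open Natural K public

  module _ {f} (hom : IsBoundedLatticeHomomorphism L.lattice K.lattice f)
           (surj : Surjective L._≈_ K._≈_ f) where
    open IsBoundedLatticeHomomorphism hom
    open Homomorphism L.lattice K.lattice hom

    -- An irreducible r outside N f and its image correspond to each other
    -- under the dual embedding of J(K) into J(L).
    reflects-≤ : ∀ {r z} → ¬ N L.lattice K.lattice f r → f r K.≤ f z → r L.≤ z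
    reflects-≤ {r} {z} r∉N fr≤fz with r L.≤? z
    ... | yes r≤z = r≤z
    ... | no  r≰z = contradiction
      ( r L.∧ z
      , (L.x∧y≤x r z , λ eq → r≰z (L.trans (L.reflexive (L.Eq.sym eq)) (L.x∧y≤y r z)))
      , K.Eq.trans (∧-homo r z)
          (K.antisym (K.x∧y≤x (f r) (f z)) (K.∧-greatest K.refl fr≤fz)))
      r∉N

    image-irreducible : ∀ {r} → L.JoinIrreducible r → ¬ N L.lattice K.lattice f r →
                        K.JoinIrreducible (f r)
    image-irreducible {r} irr r∉N = nonzero , irreducible
      where
      nonzero : ¬ f r K.≈ K.𝟎
      nonzero eq = L.irreducible-≰𝟎 irr (reflects-≤ r∉N
        (K.reflexive (K.Eq.trans eq (K.Eq.sym 𝟎-homo))))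

      irreducible : ∀ a b → f r K.≈ a K.∨ b → f r K.≈ a ⊎ f r K.≈ b
      irreducible a b eq with surj a | surj b
      ... | a′ , ↦a | b′ , ↦b = Sum.map
          (λ r≤a′ → K.antisym (K.trans (mono r≤a′) (K.reflexive (↦a L.Eq.refl)))
             (K.trans (K.x≤x∨y a b) (K.reflexive (K.Eq.sym eq))))
          (λ r≤b′ → K.antisym (K.trans (mono r≤b′) (K.reflexive (↦b L.Eq.refl)))
             (K.trans (K.y≤x∨y a b) (K.reflexive (K.Eq.sym eq))))
          (L.irreducible-prime irr (reflects-≤ r∉N (K.reflexive
            (K.Eq.trans eq (K.Eq.trans
                (K.∨-cong (K.Eq.sym (↦a L.Eq.refl)) (K.Eq.sym (↦b L.Eq.refl)))
              (K.Eq.sym (∨-homo a′ b′)))))))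

    -- By contraposition: the coordinate that decides `f y ≺ f x` is the image of an irreducible `r`
    -- outside `N f`, and `r` decides `y ⁻ ≺ x ⁻`. The hypothesis says that the dual embedding of
    -- J(K) into J(L) is increasing.
    positive-criterion :
      (∀ (r r′ : L.J) →
       ¬ N L.lattice K.lattice f (proj₁ r) → ¬ N L.lattice K.lattice f (proj₁ r′) →
       (irr : K.JoinIrreducible (f (proj₁ r))) (irr′ : K.JoinIrreducible (f (proj₁ r′))) →
       (f (proj₁ r) , irr) K.⊏⁰ (f (proj₁ r′) , irr′) → r L.⊏⁰ r′) →
      Positive L K hom
    positive-criterion h x y x⁻⊑y⁻ = K.⊐̸⇒⊑ λ fy⊏fx →
      L.⊑⇒⊐̸ x⁻⊑y⁻ (L.≺⇒⊏ (descend (K.⊏⇒≺ fy⊏fx)))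
      where
      descend : f y K.≺ f x → (y ⁻) L.≺ (x ⁻)
      descend (s , (s≰fy , s≤fx) , agree)
        with ≤-image-⋁ L.lattice K.lattice hom (L.below-outside? x N?) (proj₂ s)
               (K.trans s≤fx (K.reflexive (K.Eq.sym (⁻-fibre x))))
      ... | r , (irr , r≤x , r∉N) , s≤fr =
        (r , irr) ,
        ( (λ r≤y⁻ → s≰fy (K.trans s≤fr (mono (L.trans r≤y⁻ (⁻-≤ y)))))
        , L.⋁-upper (L.below-outside? x N?) (below-outside-resp x) (irr , r≤x , r∉N) ) ,
        λ t r⊏t → transfer fr-agree t r⊏t , transfer (λ j lt → swap (fr-agree j lt)) t r⊏t
        where
        fr : K.J
        fr = f r , image-irreducible irr r∉N

        -- If `fr` came after `s`, then `f x` and `f y` would agree at `fr`, and `s ≤ fr` would put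
        -- `s` below `f y`.
        s≈fr : proj₁ s K.≈ f r
        s≈fr with K.⊏⁰-compare s fr
        ... | tri< s⊏fr _ _ = contradiction
          (K.trans s≤fr (proj₂ (agree fr s⊏fr) (mono r≤x))) s≰fy
        ... | tri≈ _ eq _ = eq
        ... | tri> _ _ fr⊏s = contradiction fr⊏s (K.≤⇒¬⊏⁰ {fr} {s} s≤fr)

        fr-agree : ∀ j → fr K.⊏⁰ j → K.Agree j (f y) (f x)
        fr-agree j fr⊏j = agree j (proj₂ K.⊏⁰-resp-≈ {j} {fr} {s} (K.Eq.sym s≈fr) fr⊏j)

        transfer : ∀ {u v} → (∀ j → fr K.⊏⁰ j → K.Agree j (f u) (f v)) →
                   ∀ t → (r , irr) L.⊏⁰ t → proj₁ t L.≤ u ⁻ → proj₁ t L.≤ v ⁻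
        -- The coordinate `t` may belong to `N f`. Being prime, it lies below a joinand `q` of
        -- `u ⁻`, which is outside `N f` and to which the hypothesis applies.
        transfer {u} {v} agree′ t r⊏t t≤u⁻
          with ≤-image-⋁ L.lattice L.lattice (PositiveSurjection.isHomomorphism (identity L))
                 (L.below-outside? u N?) (proj₂ t) t≤u⁻
        ... | q , (irr-q , q≤u , q∉N) , t≤q = result (K.⊏⁰-compare fr fq)
          where
          fq : K.J
          fq = f q , image-irreducible irr-q q∉N

          result : Tri (fr K.⊏⁰ fq) (fr K.≈ᴶ fq) (fq K.⊏⁰ fr) → proj₁ t L.≤ v ⁻
          result (tri< fr⊏fq _ _) = L.trans t≤q (reflects-≤ q∉N
            (K.trans (proj₁ (agree′ fq fr⊏fq) (mono q≤u))
                     (K.reflexive (K.Eq.sym (⁻-fibre v)))))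
          result (tri≈ _ eq _) = contradiction r⊏t (L.≤⇒¬⊏⁰ {r , irr} {t}
            (L.trans t≤q (reflects-≤ q∉N (K.reflexive (K.Eq.sym eq)))))
          result (tri> _ _ fq⊏fr) = contradiction
            (L.⊏⁰-trans (h (q , irr-q) (r , irr) q∉N r∉N _ _ fq⊏fr) r⊏t)
            (L.≤⇒¬⊏⁰ {q , irr-q} {t} t≤q)

-- Enumeration of finite setoids

module Finite (S : DecSetoid 0ℓ 0ℓ) where
  open DecSetoid S
    using (_≈_; _≟_; setoid)
    renaming (Carrier to A; sym to ≈-sym; trans to ≈-trans; refl to ≈-refl)

  lookup-injective : ∀ {xs} → Unique setoid xs → ∀ i j →
                     List.lookup xs i ≈ List.lookup xs j → i ≡ j
  lookup-injective (_ ∷ _)  zero    zero    _  = refl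
  lookup-injective (p ∷ _)  zero    (suc j) eq = contradiction eq (All.lookup p (∈-lookup j))
  lookup-injective (p ∷ _)  (suc i) zero    eq =
    contradiction (≈-sym eq) (All.lookup p (∈-lookup i))
  lookup-injective (_ ∷ ps) (suc i) (suc j) eq = cong suc (lookup-injective ps i j eq)

  enumerate : ∀ xs → IsEnumeration setoid xs →
              Inverse (≡.setoid (Fin (List.length (deduplicate _≟_ xs)))) setoid
  enumerate xs all = record
    { to        = List.lookup ys
    ; from      = index
    ; to-cong   = λ { refl → ≈-refl }
    ; from-cong = λ {x} {y} x≈y → lookup-injective unique _ _
        (≈-trans (at-index x) (≈-trans x≈y (≈-sym (at-index y))))
    ; inverse   = (λ { {x} refl → at-index x }) ,
                  λ {i} {x} x≈ → lookup-injective unique _ _ (≈-trans (at-index x) x≈)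
    }
    where
    ys : List A
    ys = deduplicate _≟_ xs

    unique : Unique setoid ys
    unique = Unique.deduplicate-! S xs

    complete : IsEnumeration setoid ys
    complete = Enumerates.deduplicate⁺ S all

    index : A → Fin (List.length ys)
    index x = Any.index (complete x)

    at-index : ∀ x → List.lookup ys (index x) ≈ x
    at-index x = ≈-sym (Any.lookup-index (complete x))

-- Lattice terms, ordered by implication under all Boolean valuations, form the
-- free bounded distributive lattice.

data Term (n : ℕ) : Set where
  var     : Fin n → Term n
  _⊓_ _⊔_ : Term n → Term n → Term n
  bot top : Term n

Sat : Term n → Vec Bool n → Set
Sat (var i) S = T (Vec.lookup S i)
Sat (s ⊓ t) S = Sat s S × Sat t S
Sat (s ⊔ t) S = Sat s S ⊎ Sat t S
Sat bot     S = ⊥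
Sat top     S = ⊤

sat? : (t : Term n) (S : Vec Bool n) → Dec (Sat t S)
sat? (var i) S = Bool.T? (Vec.lookup S i)
sat? (s ⊓ t) S = sat? s S ×-dec sat? t S
sat? (s ⊔ t) S = sat? s S ⊎-dec sat? t S
sat? bot     S = no λ ()
sat? top     S = yes tt

Sat-mono : ∀ {S S′} → (∀ i → T (Vec.lookup S i) → T (Vec.lookup S′ i)) →
           (t : Term n) → Sat t S → Sat t S′
Sat-mono h (var i) = h i
Sat-mono h (s ⊓ t) = Product.map (Sat-mono h s) (Sat-mono h t)
Sat-mono h (s ⊔ t) = Sum.map (Sat-mono h s) (Sat-mono h t)
Sat-mono h bot     = id
Sat-mono h top     = id

infix 4 _≲_ _≲?_
-- A record, so that the terms can be inferred from a proof.
record _≲_ (s t : Term n) : Set where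
  constructor implies
  field apply : ∀ S → Sat s S → Sat t S
open _≲_

≲-refl : {s : Term n} → s ≲ s
≲-refl = implies λ _ → id

≲-trans : {s t u : Term n} → s ≲ t → t ≲ u → s ≲ u
≲-trans p q = implies λ S → apply q S ∘ apply p S

allVec? : ∀ n {P : Vec Bool n → Set} → (∀ S → Dec (P S)) → Dec (∀ S → P S)
allVec? zero    P? = map′ (λ { p [] → p }) (λ h → h []) (P? [])
allVec? (suc n) P? = map′
  (λ { (f , g) (true ∷ S) → f S ; (f , g) (false ∷ S) → g S })
  (λ h → (h ∘ (true ∷_)) , (h ∘ (false ∷_)))
  (allVec? n (P? ∘ (true ∷_)) ×-dec allVec? n (P? ∘ (false ∷_)))

_≲?_ : (s t : Term n) → Dec (s ≲ t)
s ≲? t = map′ implies apply (allVec? _ λ S → sat? s S →-dec sat? t S)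

termSetoid : ℕ → DecSetoid 0ℓ 0ℓ
termSetoid n = record
  { Carrier = Term n
  ; _≈_ = λ s t → s ≲ t × t ≲ s
  ; isDecEquivalence = record
    { isEquivalence = record
      { refl  = ≲-refl , ≲-refl
      ; sym   = swap
      ; trans = λ (p , q) (p′ , q′) → ≲-trans p p′ , ≲-trans q′ q
      }
    ; _≟_ = λ s t → (s ≲? t) ×-dec (t ≲? s)
    }
  }

bind : (Fin m → Term n) → Term m → Term n
bind f (var i) = f i
bind f (s ⊓ t) = bind f s ⊓ bind f t
bind f (s ⊔ t) = bind f s ⊔ bind f t
bind f bot     = bot
bind f top     = top

Sat-bind : ∀ (f : Fin m → Term n) S S′ →
           (∀ i → Sat (f i) S ⇔ T (Vec.lookup S′ i)) →
           ∀ t → Sat (bind f t) S ⇔ Sat t S′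
Sat-bind f S S′ h (var i) = h i
Sat-bind f S S′ h (s ⊓ t) = Sat-bind f S S′ h s ×-⇔ Sat-bind f S S′ h t
Sat-bind f S S′ h (s ⊔ t) = Sat-bind f S S′ h s ⊎-⇔ Sat-bind f S S′ h t
Sat-bind f S S′ h bot     = mk⇔ id id
Sat-bind f S S′ h top     = mk⇔ id id

cofactor₀ cofactor₁ : Term (suc n) → Term n
cofactor₀ = bind λ { zero → bot ; (suc i) → var i }
cofactor₁ = bind λ { zero → top ; (suc i) → var i }

weaken : Term n → Term (suc n)
weaken = bind (var ∘ suc)

sat-weaken : ∀ b S (t : Term n) → Sat (weaken t) (b ∷ S) ⇔ Sat t S
sat-weaken b S = Sat-bind (var ∘ suc) (b ∷ S) S λ _ → mk⇔ id id

sat-cofactor₀ : ∀ S (t : Term (suc n)) → Sat (cofactor₀ t) S ⇔ Sat t (false ∷ S)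
sat-cofactor₀ S = Sat-bind _ S (false ∷ S)
  λ { zero → mk⇔ id id ; (suc i) → mk⇔ id id }

sat-cofactor₁ : ∀ S (t : Term (suc n)) → Sat (cofactor₁ t) S ⇔ Sat t (true ∷ S)
sat-cofactor₁ S = Sat-bind _ S (true ∷ S)
  λ { zero → mk⇔ id id ; (suc i) → mk⇔ id id }

-- Shannon expansion t = t₀ ∨ (x₀ ∧ t₁); since t is monotone, t₀ needs no
-- factor ¬ x₀.
expand : Term n → Term n → Term (suc n)
expand t₀ t₁ = weaken t₀ ⊔ (var zero ⊓ weaken t₁)

≲-expand : (t : Term (suc n)) → t ≲ expand (cofactor₀ t) (cofactor₁ t)
≲-expand t = implies λ
  { (false ∷ S) h → inj₁ (⇐ (sat-weaken false S (cofactor₀ t)) (⇐ (sat-cofactor₀ S t) h))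
  ; (true  ∷ S) h → inj₂ (tt , ⇐ (sat-weaken true S (cofactor₁ t)) (⇐ (sat-cofactor₁ S t) h))
  }

expand-≲ : (t : Term (suc n)) → expand (cofactor₀ t) (cofactor₁ t) ≲ t
expand-≲ t = implies λ
  { (false ∷ S) (inj₁ h) → ⇒ (sat-cofactor₀ S t) (⇒ (sat-weaken false S (cofactor₀ t)) h)
  ; (true  ∷ S) (inj₁ h) →
      Sat-mono {S = false ∷ S} {true ∷ S} (λ { zero _ → tt ; (suc i) → id }) t
      (⇒ (sat-cofactor₀ S t) (⇒ (sat-weaken true S (cofactor₀ t)) h))
  ; (true  ∷ S) (inj₂ (_ , h)) → ⇒ (sat-cofactor₁ S t) (⇒ (sat-weaken true S (cofactor₁ t)) h)
  }

-- Pairs that are not cofactors of a term, those with `t₀` not below `t₁`, yield only repetitions,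
-- which `Finite.enumerate` removes.
terms : ∀ n → List (Term n)
terms zero    = bot ∷ top ∷ []
terms (suc n) = cartesianProductWith expand (terms n) (terms n)

expand-mono : {s s′ t t′ : Term n} → s ≲ s′ → t ≲ t′ → expand s t ≲ expand s′ t′
expand-mono {s = s} {s′} {t} {t′} p q = implies λ
  { (b ∷ S) → Sum.map (w b S s s′ p) (Product.map id (w b S t t′ q)) }
  where
  w : ∀ b S s s′ → s ≲ s′ → Sat (weaken s) (b ∷ S) → Sat (weaken s′) (b ∷ S)
  w b S s s′ p = ⇐ (sat-weaken b S s′) ∘ apply p S ∘ ⇒ (sat-weaken b S s)

terms-complete : ∀ n → IsEnumeration (DecSetoid.setoid (termSetoid n)) (terms n)
terms-complete zero t with sat? t []
... | yes h = there (here (implies (λ _ _ → tt) , implies λ { [] _ → h }))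
... | no ¬h = here (implies (λ { [] h → ¬h h }) , implies λ _ ())
terms-complete (suc n) t = SetoidMembership.∈-resp-≈ (setoid (suc n))
  (expand-≲ t , ≲-expand t)
  (SetoidMembership.∈-cartesianProductWith⁺ (setoid n) (setoid n) (setoid (suc n))
    (λ (p , p′) (q , q′) → expand-mono p q , expand-mono p′ q′)
    (terms-complete n (cofactor₀ t)) (terms-complete n (cofactor₁ t)))
  where
  setoid : ∀ n → Setoid 0ℓ 0ℓ
  setoid n = DecSetoid.setoid (termSetoid n)

freeLattice : ℕ → FiniteDistributiveLattice
freeLattice n = record
  { boundedLattice = record
    { Carrier = Term n
    ; _≈_ = DecSetoid._≈_ (termSetoid n)
    ; _≤_ = _≲_
    ; _∨_ = _⊔_
    ; _∧_ = _⊓_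
    ; ⊤ = top
    ; ⊥ = bot
    ; isBoundedLattice = record
      { isLattice = record
        { isPartialOrder = record
          { isPreorder = record
            { isEquivalence = DecSetoid.isEquivalence (termSetoid n)
            ; reflexive = proj₁
            ; trans = ≲-trans
            }
          ; antisym = _,_
          }
        ; supremum = λ s t → implies (λ _ → inj₁) , implies (λ _ → inj₂) ,
            λ _ p q → implies λ S → Sum.[ apply p S , apply q S ]
        ; infimum  = λ s t → implies (λ _ → proj₁) , implies (λ _ → proj₂) ,
            λ _ p q → implies λ S → Product.< apply p S , apply q S >
        }
      ; maximum = λ _ → implies λ _ _ → tt
      ; minimum = λ _ → implies λ _ ()
      }
    }
  ; ∧-distribˡ-∨ = λ _ _ _ →
      implies (λ { _ (a , inj₁ b) → inj₁ (a , b) ; _ (a , inj₂ c) → inj₂ (a , c) }) ,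
      implies (λ { _ (inj₁ (a , b)) → a , inj₁ b ; _ (inj₂ (a , c)) → a , inj₂ c })
  ; size = _
  ; enumeration = Finite.enumerate (termSetoid n) (terms n) (terms-complete n)
  }

-- Evaluation of terms in a lattice

module Evaluation (L : FiniteDistributiveLattice) where
  open FiniteDistributiveLattice L hiding (refl; reflexive) renaming (trans to ≤-trans)
  open Irreducibles L

  eval : Vec Carrier n → Term n → Carrier
  eval u (var i) = Vec.lookup u i
  eval u (s ⊓ t) = eval u s ∧ eval u t
  eval u (s ⊔ t) = eval u s ∨ eval u t
  eval u bot     = 𝟎
  eval u top     = 𝟏

  support : Carrier → Vec Carrier n → Vec Bool n
  support j = Vec.map λ x → ⌊ j ≤? x ⌋

  -- As `j` is prime, being above `j` is a homomorphism to truth values, so it commutes with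
  -- evaluation.
  ≤-eval : ∀ {j} → JoinIrreducible j → (u : Vec Carrier n) (t : Term n) →
           j ≤ eval u t ⇔ Sat t (support j u)
  ≤-eval {j = j} irr u (var i) = mk⇔
    (subst T (sym (Vec.lookup-map i _ u)) ∘ fromWitness)
    (toWitness ∘ subst T (Vec.lookup-map i _ u))
  ≤-eval irr u (s ⊓ t) = ⇔.equivalence
    (mk⇔ (λ h → ≤-trans h (x∧y≤x _ _) , ≤-trans h (x∧y≤y _ _)) λ (p , q) → ∧-greatest p q)
    (≤-eval irr u s ×-⇔ ≤-eval irr u t)
  ≤-eval irr u (s ⊔ t) = ⇔.equivalence
    (mk⇔ (irreducible-prime irr)
      Sum.[ (λ p → ≤-trans p (x≤x∨y _ _)) , (λ p → ≤-trans p (y≤x∨y _ _)) ])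
    (≤-eval irr u s ⊎-⇔ ≤-eval irr u t)
  ≤-eval irr u bot = mk⇔ (irreducible-≰𝟎 irr) λ ()
  ≤-eval irr u top = mk⇔ (λ _ → tt) (λ _ → maximum _)

  -- Boolean valuations suffice to compare values in `L`, because irreducibles determine its order
  -- and each of them induces a valuation.
  eval-mono : (u : Vec Carrier n) {s t : Term n} → s ≲ t → eval u s ≤ eval u t
  eval-mono u {s} {t} s≲t = ≤-by-irreducibles λ irr →
    ⇐ (≤-eval irr u t) ∘ apply s≲t _ ∘ ⇒ (≤-eval irr u s)

  eval-isHomomorphism : (u : Vec Carrier n) →
                        IsBoundedLatticeHomomorphism (freeLattice n) L (eval u)
  eval-isHomomorphism u = record
    { isLatticeHomomorphism = record
      { isRelHomomorphism = record
        { cong = λ (p , q) → antisym (eval-mono u p) (eval-mono u q) }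
      ; ∧-homo = λ _ _ → Eq.refl
      ; ∨-homo = λ _ _ → Eq.refl
      }
    ; 𝟎-homo = Eq.refl
    ; 𝟏-homo = Eq.refl
    }

  eval-cong : {u v : Vec Carrier n} → Pointwise _≈_ u v → ∀ t → eval u t ≈ eval v t
  eval-cong u≈v (var i) = Pointwise.lookup u≈v i
  eval-cong u≈v (s ⊓ t) = ∧-cong (eval-cong u≈v s) (eval-cong u≈v t)
    where open MeetSemilattice meetSemilattice using (∧-cong)
  eval-cong u≈v (s ⊔ t) = ∨-cong (eval-cong u≈v s) (eval-cong u≈v t)
  eval-cong u≈v bot     = Eq.refl
  eval-cong u≈v top     = Eq.refl

-- A natural order on the free lattice

module FreeOrder (n : ℕ) where
  open FiniteDistributiveLattice (freeLattice n)
    using (J; _≈_; _≈ᴶ_; _<ᴶ_; _≤_; _≤?_; JoinIrreducible; IsLinearExtension; Antilex)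
  open Irreducibles (freeLattice n)
  open Evaluation (freeLattice n)

  variables : Vec (Term n) n
  variables = Vec.tabulate var

  eval-variables : ∀ t → eval variables t ≡ t
  eval-variables (var i) = Vec.lookup∘tabulate var i
  eval-variables (s ⊓ t) = cong₂ _⊓_ (eval-variables s) (eval-variables t)
  eval-variables (s ⊔ t) = cong₂ _⊔_ (eval-variables s) (eval-variables t)
  eval-variables bot     = refl
  eval-variables top     = refl

  -- An irreducible term is the meet of the variables above it, hence determined by this vector.
  supp : Term n → Vec Bool n
  supp j = support j variables

  ≤⇔Sat : ∀ {j} → JoinIrreducible j → ∀ t → j ≤ t ⇔ Sat t (supp j)
  ≤⇔Sat {j} irr t = subst (λ t′ → j ≤ t′ ⇔ Sat t (supp j)) (eval-variables t)
    (≤-eval irr variables t)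

  _<ₗ_ : Rel (Vec Bool n) 0ℓ
  _<ₗ_ = Lex-< _≡_ Bool._<_

  private module <ₗ = IsStrictTotalOrder (Lex.<-isStrictTotalOrder Bool.<-isStrictTotalOrder {n})

  -- The first variable that lies above exactly one of i, j lies above i.
  _⊏⁰_ : Rel J 0ℓ
  i ⊏⁰ j = supp (proj₁ j) <ₗ supp (proj₁ i)

  supp-injective : ∀ {i j} → JoinIrreducible i → JoinIrreducible j →
                   supp i ≡ supp j → i ≈ j
  supp-injective {i} {j} irr irr′ eq =
    ⇐ (≤⇔Sat irr j)  (subst (Sat j) (sym eq) (⇒ (≤⇔Sat irr′ j) ≲-refl)) ,
    ⇐ (≤⇔Sat irr′ i) (subst (Sat i) eq (⇒ (≤⇔Sat irr i) ≲-refl))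

  -- A smaller element has more variables above it; this is why the lexicographic order has to be
  -- reversed in `_⊏⁰_`.
  support-mono : ∀ {i j} → i ≤ j → ∀ {m} (u : Vec (Term n) m) →
                 support i u ≡ support j u ⊎ Lex-< _≡_ Bool._<_ (support j u) (support i u)
  support-mono i≤j [] = inj₁ refl
  support-mono {i} {j} i≤j (x ∷ u) with i ≤? x | j ≤? x | support-mono i≤j u
  ... | yes i≤x | no  _   | _ = inj₂ (this f<t refl)
  ... | no i≰x  | yes j≤x | _ = contradiction (≲-trans i≤j j≤x) i≰x
  ... | yes _   | yes _   | inj₁ eq = inj₁ (cong (true ∷_) eq)
  ... | yes _   | yes _   | inj₂ lt = inj₂ (next refl lt)
  ... | no _    | no _    | inj₁ eq = inj₁ (cong (false ∷_) eq)
  ... | no _    | no _    | inj₂ lt = inj₂ (next refl lt)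

  supp-cong : ∀ {i j} → i ≈ j → supp i ≡ supp j
  supp-cong (i≤j , j≤i) with support-mono i≤j variables | support-mono j≤i variables
  ... | inj₁ eq | _       = eq
  ... | _       | inj₁ eq = sym eq
  ... | inj₂ p  | inj₂ q  = contradiction (<ₗ.trans p q)
    (<ₗ.irrefl (Pointwise.≡⇒Pointwise-≡ refl))

  ⊏⁰-isLinearExtension : IsLinearExtension _⊏⁰_
  ⊏⁰-isLinearExtension = record
    { isStrictTotalOrder = isStrictTotalOrderᶜ record
      { isEquivalence = record
        { refl = ≲-refl , ≲-refl ; sym = swap
        ; trans = DecSetoid.trans (termSetoid n) }
      ; trans   = λ p q → <ₗ.trans q p
      ; compare = compare
      }
    ; extends = λ {i} {j} → extends {i} {j}
    }
    where
    compare : Trichotomous _≈ᴶ_ _⊏⁰_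
    compare (i , irr) (j , irr′) with <ₗ.compare (supp i) (supp j)
    ... | tri< lt ¬eq ¬gt = tri> ¬gt (¬eq ∘ Pointwise.≡⇒Pointwise-≡ ∘ supp-cong) lt
    ... | tri≈ ¬lt eq ¬gt = tri≈ ¬gt (supp-injective irr irr′ (Pointwise.Pointwise-≡⇒≡ eq)) ¬lt
    ... | tri> ¬lt ¬eq gt = tri< gt (¬eq ∘ Pointwise.≡⇒Pointwise-≡ ∘ supp-cong) ¬lt

    extends : ∀ {i j} → i <ᴶ j → i ⊏⁰ j
    extends {i , irr} {j , irr′} (i≤j , i≉j) with support-mono i≤j variables
    ... | inj₁ eq = contradiction (supp-injective irr irr′ eq) i≉j
    ... | inj₂ lt = lt

  freeNatural : NaturallyOrderedLattice
  freeNatural = record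
    { lattice = freeLattice n
    ; _⊏_     = Antilex _⊏⁰_
    ; isNaturalOrder = record
      { isStrictTotalOrder = LinearExtension.antilex-isStrictTotalOrder ⊏⁰-isLinearExtension
      ; _⊏⁰_ = _⊏⁰_
      ; isLinearExtension = ⊏⁰-isLinearExtension
      ; antilex = λ _ _ → mk⇔ id id
      }
    }

-- Words as positive surjections

decode : (Fin a → X) → Vec X m → Word a m n → Vec X n
decode ρ xs       []      = []
decode ρ xs       (c ∷ w) = ρ c ∷ decode ρ xs w
decode ρ (x ∷ xs) (ν w)   = x ∷ decode (x ▹ ρ) xs w

decode-cong : {ρ ρ′ : Fin a → X} → ρ ≗ ρ′ → (xs : Vec X m) (w : Word a m n) →
              decode ρ xs w ≡ decode ρ′ xs w
decode-cong ρ≗ρ′ xs       []      = refl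
decode-cong ρ≗ρ′ xs       (c ∷ w) = cong₂ _∷_ (ρ≗ρ′ c) (decode-cong ρ≗ρ′ xs w)
decode-cong ρ≗ρ′ (x ∷ xs) (ν w)   = cong (x ∷_) (decode-cong (▹-cong ρ≗ρ′) xs w)

decode-sub : (ρ : Fin b → X) (xs : Vec X m) (σ : Fin a → Fin b)
             (w : Word a l n) (v : Word b m l) →
             decode ρ xs (sub σ w v) ≡ decode (ρ ∘ σ) (decode ρ xs v) w
decode-sub ρ []       σ []      []      = refl
decode-sub ρ xs       σ (c ∷ w) v       = cong (ρ (σ c) ∷_) (decode-sub ρ xs σ w v)
decode-sub ρ xs       σ (ν w)   (c ∷ v) = cong (ρ c ∷_)
  (trans (decode-sub ρ xs (c ▹ σ) w v) (decode-cong (∘-▹ ρ c σ) _ w))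
decode-sub ρ (x ∷ xs) σ (ν w)   (ν v)   = cong (x ∷_)
  (trans (decode-sub (x ▹ ρ) xs (lift σ) w v) (decode-cong (▹-∘-lift x ρ σ) _ w))

map-decode : (f : X → Y) (ρ : Fin a → X) (xs : Vec X m) (w : Word a m n) →
             Vec.map f (decode ρ xs w) ≡ decode (f ∘ ρ) (Vec.map f xs) w
map-decode f ρ xs       []      = refl
map-decode f ρ xs       (c ∷ w) = cong (f (ρ c) ∷_) (map-decode f ρ xs w)
map-decode f ρ (x ∷ xs) (ν w)   = cong (f x ∷_)
  (trans (map-decode f (x ▹ ρ) xs w) (decode-cong (∘-▹ f x ρ) _ w))

decode-pointwise : {_≈_ : Rel X 0ℓ} {ρ ρ′ : Fin a → X} → (∀ c → ρ c ≈ ρ′ c) →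
                   {xs ys : Vec X m} → Pointwise _≈_ xs ys → (w : Word a m n) →
                   Pointwise _≈_ (decode ρ xs w) (decode ρ′ ys w)
decode-pointwise ρ≈ρ′ xs≈ys         []      = []
decode-pointwise ρ≈ρ′ xs≈ys         (c ∷ w) = ρ≈ρ′ c ∷ decode-pointwise ρ≈ρ′ xs≈ys w
decode-pointwise ρ≈ρ′ (x≈y ∷ xs≈ys) (ν w)   =
  x≈y ∷ decode-pointwise (λ { zero → x≈y ; (suc c) → ρ≈ρ′ c }) xs≈ys w

decode-params : {P : X → Set} (ρ : Fin a → X) {xs : Vec X m} → Anyᵛ P xs → (w : Word a m n) →
                Anyᵛ P (decode ρ xs w)
decode-params ρ p         (c ∷ w) = there (decode-params ρ p w)
decode-params ρ (here p)  (ν w)   = here p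
decode-params ρ (there p) (ν w)   = there (decode-params _ p w)

module Words (K : NaturallyOrderedLattice) where
  open NaturallyOrderedLattice K
    hiding (refl) renaming (trans to ≤-trans; reflexive to ≤-reflexive)
  open Natural K
  open Evaluation lattice

  infix 4 _∈ᵛ_
  _∈ᵛ_ : Carrier → Vec Carrier n → Set
  x ∈ᵛ xs = Anyᵛ (x ≈_) xs

  -- The last component is used for two properties `Q`: lying above the head `y`, for sortedness,
  -- and being nonzero.
  insert : ∀ x (xs : Vec Carrier n) → AllPairs _⊏_ xs → ∃ λ m → Σ (Vec Carrier m) λ ys →
           AllPairs _⊏_ ys × x ∈ᵛ ys × (∀ {z} → z ∈ᵛ xs → z ∈ᵛ ys) ×
           (∀ {Q : Pred Carrier 0ℓ} → Q x → Allᵛ Q xs → Allᵛ Q ys)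
  insert x [] [] = _ , x ∷ [] , [] ∷ [] , here Eq.refl , (λ ()) , λ q _ → q ∷ []
  insert x (y ∷ ys) (y⊏ ∷ s) with ⊏-compare x y
  ... | tri< x⊏y _ _ = _ , x ∷ y ∷ ys , (x⊏y ∷ Allᵛ.map (⊏-trans x⊏y) y⊏) ∷ y⊏ ∷ s ,
    here Eq.refl , there , _∷_
  ... | tri≈ _ x≈y _ = _ , y ∷ ys , y⊏ ∷ s , here x≈y , id , λ _ qs → qs
  ... | tri> _ _ y⊏x with insert x ys s
  ...   | _ , zs , s′ , x∈ , ⊆ , all = _ , y ∷ zs , all y⊏x y⊏ ∷ s′ , there x∈ ,
    (λ { (here eq) → here eq ; (there z∈) → there (⊆ z∈) }) ,
    λ { q (p ∷ ps) → p ∷ all q ps }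

  sort : ∀ xs → ∃ λ m → Σ (Vec Carrier m) λ ys → AllPairs _⊏_ ys ×
         Allᵛ (λ y → ¬ y ≈ 𝟎) ys × (∀ {x} → x ∈ xs → ¬ x ≈ 𝟎 → x ∈ᵛ ys)
  sort []       = _ , [] , [] , [] , λ ()
  sort (x ∷ xs) with x ≈? 𝟎 | sort xs
  ... | yes x≈𝟎 | _ , ys , s , nz , ⊆ = _ , ys , s , nz , λ
    { (here refl) x≉𝟎 → contradiction x≈𝟎 x≉𝟎 ; (there z∈) → ⊆ z∈ }
  ... | no x≉𝟎 | _ , ys , s , nz , ⊆ with insert x ys s
  ...   | _ , zs , s′ , x∈ , ⊆′ , all = _ , zs , s′ , all x≉𝟎 nz , λ
    { (here refl) _ → x∈ ; (there z∈) z≉𝟎 → ⊆′ (⊆ z∈ z≉𝟎) }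

  private
    sorting = sort elements

  rank : ℕ
  rank = proj₁ sorting

  nonzero : Vec Carrier rank
  nonzero = proj₁ (proj₂ sorting)

  nonzero-sorted : AllPairs _⊏_ nonzero
  nonzero-sorted = proj₁ (proj₂ (proj₂ sorting))

  nonzero-≉𝟎 : Allᵛ (λ x → ¬ x ≈ 𝟎) nonzero
  nonzero-≉𝟎 = proj₁ (proj₂ (proj₂ (proj₂ sorting)))

  ∈ᵛ-resp : ∀ {x y} {xs : Vec Carrier n} → x ≈ y → x ∈ᵛ xs → y ∈ᵛ xs
  ∈ᵛ-resp x≈y = Anyᵛ.map (Eq.trans (Eq.sym x≈y))

  nonzero-complete : ∀ x → x ≈ 𝟎 ⊎ x ∈ᵛ nonzero
  nonzero-complete x with x ≈? 𝟎 | elements-complete x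
  ... | yes x≈𝟎 | _ = inj₁ x≈𝟎
  ... | no x≉𝟎  | y , y∈ , y≈x = inj₂ (∈ᵛ-resp y≈x
    (proj₂ (proj₂ (proj₂ (proj₂ sorting))) y∈ (x≉𝟎 ∘ Eq.trans (Eq.sym y≈x))))

  -- Were `x ⊏ i`, the deciding coordinate would lie below `i` and so precede `j`; agreement at `j`
  -- would then give `j ≤ i`, against `i ⊏⁰ j`.
  ⊏⁰⇒⊏ : ∀ (i j : J) {x} → i ⊏⁰ j → proj₁ j ≤ x → ¬ proj₁ i ≤ x → proj₁ i ⊏ x
  ⊏⁰⇒⊏ i j {x} i⊏j j≤x i≰x with ⊏-compare (proj₁ i) x
  ... | tri< i⊏x _ _ = i⊏x
  ... | tri≈ _ i≈x _ = contradiction (≤-reflexive i≈x) i≰x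
  ... | tri> _ _ x⊏i with ⊏⇒≺ x⊏i
  ...   | s , (s≰x , s≤i) , agree = contradiction i⊏j (≤⇒¬⊏⁰ {i} {j} (proj₁ (agree j s⊏j) j≤x))
    where
    s⊏j : s ⊏⁰ j
    s⊏j with ⊏⁰-compare s j
    ... | tri< s⊏j _ _ = s⊏j
    ... | tri≈ _ s≈j _ = contradiction (≤-trans (≤-reflexive s≈j) j≤x) s≰x
    ... | tri> _ _ j⊏s = contradiction (⊏⁰-trans i⊏j j⊏s) (≤⇒¬⊏⁰ {i} {s} s≤i)

  -- Letters repeat values that do not separate `i` from `j`, so the first difference is at a new
  -- parameter `x`, at the latest at `i` itself. As `i` is still to come, sortedness gives `x ⊑ i`,
  -- while `j ≤ x` without `i ≤ x` would give `i ⊏ x`.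
  support-decode : ∀ (i j : J) → i ⊏⁰ j → (ρ : Fin a → Carrier) (xs : Vec Carrier m) →
                   (∀ c → (proj₁ i ≤ ρ c → proj₁ j ≤ ρ c) × (proj₁ j ≤ ρ c → proj₁ i ≤ ρ c)) →
                   AllPairs _⊏_ xs → proj₁ i ∈ᵛ xs → (w : Word a m n) →
                   Lex-< _≡_ Bool._<_ (support (proj₁ j) (decode ρ xs w))
                                      (support (proj₁ i) (decode ρ xs w))
  support-decode i j i⊏j ρ xs eq s i∈ (c ∷ w)
    with proj₁ i ≤? ρ c | proj₁ j ≤? ρ c | support-decode i j i⊏j ρ xs eq s i∈ w
  ... | yes _   | yes _   | lt = next refl lt
  ... | no _    | no _    | lt = next refl lt
  ... | yes i≤c | no j≰c  | _  = contradiction (proj₁ (eq c) i≤c) j≰c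
  ... | no i≰c  | yes j≤c | _  = contradiction (proj₂ (eq c) j≤c) i≰c
  support-decode i j i⊏j ρ (x ∷ xs) eq (x⊏ ∷ s) i∈ (ν w)
    with proj₁ i ≤? x | proj₁ j ≤? x
  ... | yes i≤x | no j≰x  = this f<t refl
  ... | no i≰x  | yes j≤x = contradiction (⊏⁰⇒⊏ i j i⊏j j≤x i≰x) (⊑⇒⊐̸ (x⊑i i∈))
    where
    x⊑i : proj₁ i ∈ᵛ x ∷ xs → x ⊑ proj₁ i
    x⊑i (here i≈x)  = inj₂ (Eq.sym i≈x)
    x⊑i (there i∈′) with Allᵛ.lookupAny x⊏ i∈′
    ... | x⊏y , i≈y = inj₁ (proj₁ ⊏-resp-≈ (Eq.sym i≈y) x⊏y)
  ... | yes i≤x | yes j≤x = next refl (support-decode i j i⊏j (x ▹ ρ) xs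
    (λ { zero → (λ _ → j≤x) , (λ _ → i≤x) ; (suc c) → eq c }) s (tail i∈) w)
    where
    tail : proj₁ i ∈ᵛ x ∷ xs → proj₁ i ∈ᵛ xs
    tail (there i∈′) = i∈′
    tail (here i≈x)  = contradiction i⊏j
      (≤⇒¬⊏⁰ {i} {j} (≤-trans j≤x (≤-reflexive (Eq.sym i≈x))))
  ... | no i≰x  | no j≰x  = next refl (support-decode i j i⊏j (x ▹ ρ) xs
    (λ { zero → (λ i≤x → contradiction i≤x i≰x) , (λ j≤x → contradiction j≤x j≰x)
       ; (suc c) → eq c }) s (tail i∈) w)
    where
    tail : proj₁ i ∈ᵛ x ∷ xs → proj₁ i ∈ᵛ xs
    tail (there i∈′) = i∈′
    tail (here i≈x)  = contradiction (≤-reflexive i≈x) i≰x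

  values : Word 1 rank n → Vec Carrier n
  values = decode (const 𝟎) nonzero

  wordHom : Word 1 rank n → PositiveSurjection (FreeOrder.freeNatural n) K
  wordHom {n} w = record
    { ⟦_⟧            = eval (values w)
    ; isHomomorphism = hom
    ; surjective     = surj
    ; positive       = positive-criterion freeNatural K hom surj order
    }
    where
    open FreeOrder n using (freeNatural; supp)
    hom = eval-isHomomorphism (values w)

    surj : Surjective (FiniteDistributiveLattice._≈_ (freeLattice n)) _≈_ (eval (values w))
    surj y with nonzero-complete y
    ... | inj₁ y≈𝟎 = bot , λ eq → Eq.trans
        (IsBoundedLatticeHomomorphism.⟦⟧-cong hom eq) (Eq.sym y≈𝟎)
    ... | inj₂ y∈  = var (Anyᵛ.index y∈w) , λ eq → Eq.trans
        (IsBoundedLatticeHomomorphism.⟦⟧-cong hom eq) (Eq.sym (lookup-index y∈w))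
      where y∈w = decode-params (const 𝟎) y∈ w

    -- Outside `N f` the map reflects the order, so the comparison of irreducibles of the free
    -- lattice can be carried out on their images in `K`.
    support-variables : ∀ {r} → ¬ N (freeLattice n) lattice (eval (values w)) r →
                        supp r ≡ support (eval (values w) r) (values w)
    support-variables {r} r∉N = begin
      Vec.map (λ x → ⌊ r F.≤? x ⌋) (Vec.tabulate var)
        ≡⟨ Vec.tabulate-∘ (λ x → ⌊ r F.≤? x ⌋) var ⟨
      Vec.tabulate (λ i → ⌊ r F.≤? var i ⌋)
        ≡⟨ Vec.tabulate-cong same ⟩
      Vec.tabulate (λ i → ⌊ eval (values w) r ≤? Vec.lookup (values w) i ⌋)
        ≡⟨ Vec.tabulate-∘ (λ x → ⌊ eval (values w) r ≤? x ⌋) (Vec.lookup (values w)) ⟩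
      Vec.map (λ x → ⌊ eval (values w) r ≤? x ⌋) (Vec.tabulate (Vec.lookup (values w)))
        ≡⟨ cong (Vec.map _) (Vec.tabulate∘lookup (values w)) ⟩
      Vec.map (λ x → ⌊ eval (values w) r ≤? x ⌋) (values w) ∎
      where
      open ≡-Reasoning
      module F = FiniteDistributiveLattice (freeLattice n)
      same : ∀ i → ⌊ r F.≤? var i ⌋ ≡ ⌊ eval (values w) r ≤? Vec.lookup (values w) i ⌋
      same i = begin
        ⌊ r F.≤? var i ⌋         ≡⟨ isYes≗does (r F.≤? var i) ⟩
        does (r F.≤? var i)      ≡⟨ does-⇔ (mk⇔ (eval-mono (values w))
                                      (reflects-≤ freeNatural K hom surj r∉N))
                                      (r F.≤? var i) (eval (values w) r ≤? _) ⟩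
        does (eval (values w) r ≤? Vec.lookup (values w) i)
                                 ≡⟨ isYes≗does (eval (values w) r ≤? Vec.lookup (values w) i) ⟨
        ⌊ eval (values w) r ≤? Vec.lookup (values w) i ⌋ ∎

    order : ∀ r r′ → ¬ N (freeLattice n) lattice (eval (values w)) (proj₁ r) →
            ¬ N (freeLattice n) lattice (eval (values w)) (proj₁ r′) →
            ∀ irr irr′ →
            (eval (values w) (proj₁ r) , irr) ⊏⁰ (eval (values w) (proj₁ r′) , irr′) →
            Lex-< _≡_ Bool._<_ (supp (proj₁ r′)) (supp (proj₁ r))
    order (r , _) (r′ , _) r∉N r′∉N irr irr′ lt
      rewrite support-variables r∉N | support-variables r′∉N =
      support-decode (_ , irr) (_ , irr′) lt (const 𝟎) nonzero
        -- The only letter stands for 𝟎, below which there is no irreducible.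
        (λ _ → (λ p → contradiction p (irreducible-≰𝟎 irr))
             , (λ p → contradiction p (irreducible-≰𝟎 irr′)))
        nonzero-sorted (member (nonzero-complete _)) w
      where
      member : _ → eval (values w) r ∈ᵛ nonzero
      member (inj₁ ≈𝟎) = contradiction ≈𝟎 (proj₁ irr)
      member (inj₂ ∈) = ∈

-- Positive surjections as words

module _ {L K : NaturallyOrderedLattice} (f : PositiveSurjection L K) where
  private
    module L where
      open NaturallyOrderedLattice L public
      open Natural L public
      open Words L public
    module K where
      open NaturallyOrderedLattice K public
      open Natural K public
      open Words K public
    open PositiveSurjection f

  Seen : (Fin a → K.Carrier) → K.Carrier → Set
  Seen ρ y = ∃ λ c → y K.≈ ρ c

  -- Positivity says that f is a rigid surjection: the least element of the fibre
  -- over y increases with y.  Hence, as x runs through L in increasing order, the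
  -- values f x appear for the first time in increasing order.
  wordFrom : (ρ : Fin a → K.Carrier) (ys : Vec K.Carrier m) (xs : Vec L.Carrier n) →
             AllPairs K._⊏_ ys → AllPairs L._⊏_ xs →
             (∀ x → Seen ρ (⟦_⟧ x) ⊎ x L.∈ᵛ xs) → (∀ y → Seen ρ y ⊎ y K.∈ᵛ ys) →
             Allᵛ (λ y → ¬ Seen ρ y) ys →
             Σ (Word a m n) λ w → Pointwise K._≈_ (decode ρ ys w) (Vec.map ⟦_⟧ xs)
  wordFrom ρ []       []       _ _ _    _ _          = [] , []
  wordFrom ρ (y ∷ ys) []       _ _ covL _ (new ∷ _)
    with surjective y
  ... | x , x↦ with covL x
  ...   | inj₁ (c , eq) = contradiction (c , K.Eq.trans (K.Eq.sym (x↦ L.Eq.refl)) eq) new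
  wordFrom ρ ys       (x ∷ xs) sK (x⊏ ∷ sL) covL covK new with covK (⟦_⟧ x)
  ... | inj₁ (c , eq) with wordFrom ρ ys xs sK sL covL′ covK new
    where
    covL′ : ∀ z → Seen ρ (⟦_⟧ z) ⊎ z L.∈ᵛ xs
    covL′ z with covL z
    ... | inj₁ seen         = inj₁ seen
    ... | inj₂ (here z≈x)   = inj₁ (c , K.Eq.trans (⟦⟧-cong z≈x) eq)
    ... | inj₂ (there z∈)   = inj₂ z∈
  ...   | w , h = c ∷ w , K.Eq.sym eq ∷ h
  wordFrom ρ (y ∷ ys) (x ∷ xs) (y⊏ ∷ sK) (x⊏ ∷ sL) covL covK (newʸ ∷ new) | inj₂ (here fx≈y)
    with wordFrom (y ▹ ρ) ys xs sK sL covL′ covK′ new′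
    where
    covL′ : ∀ z → Seen (y ▹ ρ) (⟦_⟧ z) ⊎ z L.∈ᵛ xs
    covL′ z with covL z
    ... | inj₁ (c , eq)   = inj₁ (suc c , eq)
    ... | inj₂ (here z≈x) = inj₁ (zero , K.Eq.trans (⟦⟧-cong z≈x) fx≈y)
    ... | inj₂ (there z∈) = inj₂ z∈

    covK′ : ∀ z → Seen (y ▹ ρ) z ⊎ z K.∈ᵛ ys
    covK′ z with covK z
    ... | inj₁ (c , eq)   = inj₁ (suc c , eq)
    ... | inj₂ (here z≈y) = inj₁ (zero , z≈y)
    ... | inj₂ (there z∈) = inj₂ z∈

    new′ : Allᵛ (λ z → ¬ Seen (y ▹ ρ) z) ys
    new′ = Allᵛ.map
      (λ { (¬seen , _) (suc c , eq)  → ¬seen (c , eq)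
         ; (_ , y⊏z)   (zero , z≈y) → K.⊏-irrefl (K.Eq.sym z≈y) y⊏z })
      (Allᵛ.zip (new , y⊏))
  ... | w , h = ν w , K.Eq.sym fx≈y ∷ h
  -- No later value can appear before `y`: the least point `z ⁻` of the fibre over `y` is still to
  -- come, so `x ⊑ z ⁻`, and positivity yields `f x ⊑ y`.
  wordFrom ρ (y ∷ ys) (x ∷ xs) (y⊏ ∷ sK) (x⊏ ∷ sL) covL covK (newʸ ∷ new) | inj₂ (there fx∈)
    with surjective y
  ... | z , z↦ with Allᵛ.lookupAny y⊏ fx∈ | covL (z ⁻)
  ...   | y⊏y′ , fx≈y′ | inj₁ (c , eq) = contradiction (c , K.Eq.trans (K.Eq.sym fz⁻≈y) eq) newʸ
    where fz⁻≈y = K.Eq.trans (⁻-fibre z) (z↦ L.Eq.refl)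
  ...   | y⊏y′ , fx≈y′ | inj₂ z⁻∈ = contradiction
    (proj₁ K.⊏-resp-≈ (K.Eq.sym fx≈y′) y⊏y′)
    (K.⊑⇒⊐̸ (K.⊑-resp K.Eq.refl (z↦ L.Eq.refl)
      (positive x z (L.⊑-trans (L.≤⇒⊑ (⁻-≤ x)) (x⊑z⁻ z⁻∈)))))
    where
    x⊑z⁻ : z ⁻ L.∈ᵛ x ∷ xs → x L.⊑ z ⁻
    x⊑z⁻ (here eq)  = inj₂ (L.Eq.sym eq)
    x⊑z⁻ (there ∈xs) with Allᵛ.lookupAny x⊏ ∈xs
    ... | x⊏x′ , eq = inj₁ (proj₁ L.⊏-resp-≈ (L.Eq.sym eq) x⊏x′)

  word : Σ (Word 1 K.rank L.rank) λ w → Pointwise K._≈_ (K.values w) (Vec.map ⟦_⟧ L.nonzero)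
  word = wordFrom (const K.𝟎) K.nonzero L.nonzero K.nonzero-sorted L.nonzero-sorted
    (λ x → Sum.map₁ (λ x≈𝟎 → zero , K.Eq.trans (⟦⟧-cong x≈𝟎) 𝟎-homo) (L.nonzero-complete x))
    (λ y → Sum.map₁ (zero ,_) (K.nonzero-complete y))
    (Allᵛ.map (λ y≉𝟎 (_ , y≈𝟎) → y≉𝟎 y≈𝟎) K.nonzero-≉𝟎)

  -- The word of f ∘ w is w ⊙ word.
  values-⊙ : (w : Word 1 L.rank n) →
             Pointwise K._≈_ (K.values (w ⊙ proj₁ word)) (Vec.map ⟦_⟧ (L.values w))
  values-⊙ w
    rewrite decode-sub (const K.𝟎) K.nonzero id w (proj₁ word)
          | map-decode ⟦_⟧ (const L.𝟎) L.nonzero w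
    = decode-pointwise (λ _ → K.Eq.sym 𝟎-homo) (proj₂ word) w

  eval-map : (u : Vec L.Carrier n) (t : Term n) →
             ⟦_⟧ (Evaluation.eval L.lattice u t) K.≈ Evaluation.eval K.lattice (Vec.map ⟦_⟧ u) t
  eval-map u (var i) = K.Eq.reflexive (sym (Vec.lookup-map i ⟦_⟧ u))
  eval-map u (s ⊓ t) = K.Eq.trans (∧-homo _ _) (∧-cong (eval-map u s) (eval-map u t))
    where open MeetSemilattice K.meetSemilattice using (∧-cong)
  eval-map u (s ⊔ t) = K.Eq.trans (∨-homo _ _) (K.∨-cong (eval-map u s) (eval-map u t))
  eval-map u bot     = 𝟎-homo
  eval-map u top     = 𝟏-homo

-- From colourings of morphisms to colourings of words

module _ {ℓ k} {S : Setoid ℓ ℓ} (M : Coloring k S) where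
  open Setoid S using (_≈_; Carrier)
  open Coloring M

  color : Carrier → Fin k
  color x = proj₁ (cover x)

  -- By disjointness of the parts. It is needed because a composite and the morphism of its word
  -- agree only pointwise.
  color-cong : ∀ {x y} → x ≈ y → color x ≡ color y
  color-cong {x} {y} x≈y with color x Fin.≟ color y
  ... | yes eq  = eq
  ... | no  neq = contradiction
    (resp (color x) x≈y (proj₂ (cover x)) , proj₂ (cover y)) (disjoint neq)

module _ (K L : NaturallyOrderedLattice) where
  private
    module K where
      open NaturallyOrderedLattice K public
      open Words K public
      open Evaluation lattice public
    module L where
      open NaturallyOrderedLattice L public
      open Words L public
      open Evaluation lattice public

  compose-wordHom : (f : PositiveSurjection L K) (w : Word 1 L.rank n) →
                    ∀ t → PositiveSurjection.⟦_⟧ f (L.eval (L.values w) t) K.≈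
                          K.eval (K.values (w ⊙ proj₁ (word f))) t
  compose-wordHom f w t = K.Eq.trans
    (eval-map f (L.values w) t)
    (K.Eq.sym (K.eval-cong (values-⊙ f w) t))

  -- It suffices to control the colours of morphisms given by words, since composing such a morphism
  -- with any `f` gives one again.
  monochromatic-morphism : ∀ {k} → let N = FreeOrder.freeNatural n in
    (M : Coloring k (positiveSurjections N K)) →
    (Σ (Word 1 L.rank n) λ w → ∃ λ i → ∀ v → color M (K.wordHom (w ⊙ v)) ≡ i) →
    ∃ λ i → ∃ λ (w : PositiveSurjection N L) → ∀ f → Coloring.part M i (compose f w)
  monochromatic-morphism M (w , i , mono) = i , L.wordHom w , λ f →
    subst (λ j → Coloring.part M j (compose f (L.wordHom w)))
      (trans (color-cong M {compose f (L.wordHom w)} {K.wordHom (w ⊙ proj₁ (word f))}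
               (compose-wordHom f w))
             (mono (proj₁ (word f))))
      (proj₂ (Coloring.cover M (compose f (L.wordHom w))))

corollary3p8 : DualRamseyProperty D′
corollary3p8 k 2≤k K L _ =
  FreeOrder.freeNatural (proj₁ ramsey) , λ M →
  monochromatic-morphism K L M
    -- The bound `2 ≤ k` provides the default colour.
    (proj₂ ramsey (λ v → color M (Words.wordHom K v)) (Fin.fromℕ< (ℕ.<-≤-trans z<s 2≤k)))
  where
  -- The argument 0 means an alphabet of one letter, the one for 𝟎.
  ramsey = graham-rothschild (Words.rank K) k 0 (Words.rank L)
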